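{- Let $(X,\Sigma,\mu)$ be a measure space and let $f : X\to\mathbb{R}$ be a nonnegative Bochner-integrable function (with $\mathbb{R}$ viewed as a Banach space over itself). Then the Bochner integral of $f$ equals its Lebesgue integral as a nonnegative measurable function: $$\int f\,d\mu = \int_{\mathcal{M}_+} f\,d\mu .$$
   Context: A function is nonnegative if all its values are $\ge 0$. For a nonnegative measurable function $h$ on $X$, the Lebesgue integral is $\int_{\mathcal{M}_+} h\,d\mu := \sup \int_{\mathcal{SF}_+}\psi\,d\mu \in [0,+\infty]$, where the supremum is over nonnegative measurable simple functions $\psi$ (finitely many real values) with $\psi\le h$ pointwise, and $\int_{\mathcal{SF}_+}\psi\,d\mu = \sum_{v}v\,\mu(\psi^{ -1}(\{v\}))$ with $0\cdot\infty=0$. Let $E=\mathbb{R}$ with its usual norm and Borel $\sigma$-algebra. A function $s : X \to E$ is simple when its range is finite and all preimages $s^{ -1}(\{v\})$, $v\in E$, are measurable. A simple function $s$ is integrable when $\mu(s^{ -1}(\{v\})) < \infty$ for every $v\neq 0$; its Bochner integral is then $\int s\,d\mu := \sum_{v\in E}\mu(s^{ -1}(\{v\}))\cdot v$, a finite sum, with the convention $\infty\cdot 0 := 0$. A function $f : X\to E$ is Bochner-integrable (with regard to $\mu$) when there exists a sequence $(s_n)_{n\in\mathbb{N}}$ of integrable simple functions $X\to E$ such that $s_n(x)\to f(x)$ as $n\to\infty$ for all $x\in X$, and $\int_{\mathcal{M}_+}|f-s_n|\,d\mu \to 0$ as $n\to\infty$. (Such an $f$ is measurable.) The Bochner integral of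 $f$ is then $\int f\,d\mu := \lim_{n\to\infty}\int s_n\,d\mu$; this limit exists and does not depend on the choice of such a sequence $(s_n)$. -}

module Defs where

open import Level using (Level; 0ℓ) renaming (suc to lsuc; _⊔_ to _⊔ˡ_)
open import Algebra.Bundles using (CommutativeRing)
import Algebra.Construct.NaturalChoice.Max as Max
open import Axiom.ExcludedMiddle using (ExcludedMiddle)
open import Data.List.Base using (List; foldr; map)
open import Data.List.Relation.Unary.All as All using (All)
open import Data.List.Relation.Unary.Any using (Any)
import Data.List.Relation.Unary.Unique.Setoid as UniqueSetoid
open import Data.Nat.Base as ℕ using (ℕ; zero; suc)
open import Data.Product.Base using (Σ; ∃; _×_; _,_; proj₁; proj₂)
open import Data.Sum.Base using (_⊎_; inj₁; inj₂)
open import Function.Base using (_∘_; _on_)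
open import Relation.Binary.Bundles using (TotalOrder)
open import Relation.Binary.Core using (Rel)
open import Relation.Binary.PropositionalEquality.Core using (_≡_; _≢_)
open import Relation.Binary.Structures using (IsTotalOrder)
import Relation.Binary.Construct.Add.Supremum.Equality as AddSupEquality
import Relation.Binary.Construct.Add.Supremum.NonStrict as AddSupNonStrict
import Relation.Binary.Construct.Add.Supremum.Strict as AddSupStrict
open import Relation.Nullary.Construct.Add.Supremum using (_⁺; ⊤⁺; [_])
open import Relation.Nullary.Decidable.Core
  using (yes; no; True; toWitness; fromWitness)
open import Relation.Nullary.Negation.Core using (¬_; contradiction)
open import Relation.Unary using (Pred; _≐_; _⊥_; ∁; U; ∅; ⋃)

private variable
  a ℓ p m : Level

IsUpperBound : {A : Set a} → Rel A ℓ → Pred A p → A → Set (a ⊔ˡ ℓ ⊔ˡ p)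
IsUpperBound _≤_ P u = ∀ x → P x → x ≤ u

IsLub : {A : Set a} → Rel A ℓ → Pred A p → A → Set (a ⊔ˡ ℓ ⊔ˡ p)
IsLub _≤_ P s = IsUpperBound _≤_ P s × (∀ u → IsUpperBound _≤_ P u → s ≤ u)

-- The real numbers, characterised (uniquely up to isomorphism, in classical
-- logic) as a Dedekind-complete ordered field.
record CompleteOrderedField : Set₁ where
  infix 4 _≤_
  field
    commutativeRing : CommutativeRing 0ℓ 0ℓ

  open CommutativeRing commutativeRing public
    renaming (refl to ≈-refl; sym to ≈-sym; trans to ≈-trans)

  field
    0≉1          : 0# ≉ 1#
    inverse      : ∀ x → x ≉ 0# → ∃ λ y → x * y ≈ 1#
    _≤_          : Rel Carrier 0ℓ
    isTotalOrder : IsTotalOrder _≈_ _≤_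
    +-monoˡ-≤    : ∀ {x y} z → x ≤ y → x + z ≤ y + z
    *-nonNeg     : ∀ {x y} → 0# ≤ x → 0# ≤ y → 0# ≤ x * y
    complete     : (P : Pred Carrier 0ℓ) → ∃ P → ∃ (IsUpperBound _≤_ P) →
                   ∃ (IsLub _≤_ P)

  totalOrder : TotalOrder 0ℓ 0ℓ 0ℓ
  totalOrder = record { isTotalOrder = isTotalOrder }

  open IsTotalOrder isTotalOrder public
    using (total; antisym; ≤-respʳ-≈; ≤-respˡ-≈)
    renaming (refl to ≤-refl; reflexive to ≤-reflexive; trans to ≤-trans)
  open Max totalOrder public using (_⊔_)

  infix 4 _<_
  _<_ : Rel Carrier 0ℓ
  x < y = x ≤ y × x ≉ y

  ∣_∣ : Carrier → Carrier
  ∣ x ∣ = x ⊔ - x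

  infix 4 _⟶_
  _⟶_ : (ℕ → Carrier) → Carrier → Set
  u ⟶ l = ∀ ε → 0# < ε → ∃ λ N → ∀ n → N ℕ.≤ n → ∣ u n - l ∣ < ε

-- Everything below is classical: suprema in [0,∞] and the convention 0 · ∞ = 0
-- need case distinctions that excluded middle provides.
module Integration (em : ∀ {ℓ} → ExcludedMiddle ℓ) (𝓡 : CompleteOrderedField) where

  open CompleteOrderedField 𝓡 public
    renaming (Carrier to ℝ)

  ℝ≥0 : Set
  ℝ≥0 = ∃ λ r → 0# ≤ r

  [0,∞] : Set
  [0,∞] = ℝ≥0 ⁺

  pattern ∞ = ⊤⁺

  open AddSupEquality (_≈_ on proj₁ {B = 0# ≤_}) public
    using (_≈⁺_; [_]; ⊤⁺≈⊤⁺)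
  open AddSupNonStrict (_≤_ on proj₁ {B = 0# ≤_}) public
    using (_≤⁺_; [_]; _≤⊤⁺)
  open AddSupStrict (_<_ on proj₁ {B = 0# ≤_}) public
    using (_<⁺_; [_]; [_]<⊤⁺)

  0₊ : ℝ≥0
  0₊ = 0# , ≤-refl

  infixl 6 _+⁺_
  _+⁺_ : [0,∞] → [0,∞] → [0,∞]
  [ r , 0≤r ] +⁺ [ t , 0≤t ] = [ r + t , ≤-trans 0≤t
    (≤-respˡ-≈ (+-identityˡ t) (+-monoˡ-≤ t 0≤r)) ]
  [ _ ]       +⁺ ∞           = ∞
  ∞           +⁺ _           = ∞

  infixl 7 _·⁺_
  _·⁺_ : ℝ≥0 → [0,∞] → [0,∞]
  (v , 0≤v) ·⁺ [ r , 0≤r ] = [ v * r , *-nonNeg 0≤v 0≤r ]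
  (v , _)   ·⁺ ∞ with em {P = v ≈ 0#}
  ... | yes _ = [ 0₊ ]
  ... | no  _ = ∞

  -- `complete` only speaks about small predicates; excluded middle replaces P by
  -- the equivalent small predicate `True em`.  Adjoining 0 makes the set
  -- nonempty without changing its supremum in [0,∞].
  supremum : (P : Pred [0,∞] p) → ∃ (IsLub _≤⁺_ P)
  supremum P with em {P = ∃ λ b → IsUpperBound _≤⁺_ P [ b ]}
  ... | no  unbounded = ∞ , (λ x _ → x ≤⊤⁺) , least
    where
    least : ∀ u → IsUpperBound _≤⁺_ P u → ∞ ≤⁺ u
    least ∞     _  = ∞ ≤⊤⁺
    least [ b ] ub = contradiction (b , ub) unbounded
  ... | yes ((b , 0≤b) , bounded) = [ s , 0≤s ] , upper , least
    where
    Q : Pred ℝ 0ℓ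
    Q r = r ≈ 0# ⊎ Σ (0# ≤ r) λ 0≤r → True (em {P = P [ r , 0≤r ]})

    Q-bounded : IsUpperBound _≤_ Q b
    Q-bounded r (inj₁ r≈0) = ≤-respˡ-≈ (≈-sym r≈0) 0≤b
    Q-bounded r (inj₂ (0≤r , Pr)) with bounded [ r , 0≤r ] (toWitness Pr)
    ... | [ r≤b ] = r≤b

    lub : ∃ (IsLub _≤_ Q)
    lub = complete Q (0# , inj₁ ≈-refl) (b , Q-bounded)

    s : ℝ
    s = proj₁ lub

    0≤s : 0# ≤ s
    0≤s = proj₁ (proj₂ lub) 0# (inj₁ ≈-refl)

    upper : IsUpperBound _≤⁺_ P [ s , 0≤s ]
    upper [ r , 0≤r ] Pr = [ proj₁ (proj₂ lub) r (inj₂ (0≤r , fromWitness Pr)) ]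
    upper ∞           P∞ with () ← bounded ∞ P∞

    least : ∀ u → IsUpperBound _≤⁺_ P u → [ s , 0≤s ] ≤⁺ u
    least ∞           _  = _ ≤⊤⁺
    least [ u , 0≤u ] ub = [ proj₂ (proj₂ lub) u Q≤u ]
      where
      Q≤u : IsUpperBound _≤_ Q u
      Q≤u r (inj₁ r≈0) = ≤-respˡ-≈ (≈-sym r≈0) 0≤u
      Q≤u r (inj₂ (0≤r , Pr)) with ub [ r , 0≤r ] (toWitness Pr)
      ... | [ r≤u ] = r≤u

  ⨆ : Pred [0,∞] p → [0,∞]
  ⨆ P = proj₁ (supremum P)

  partialSum : (ℕ → [0,∞]) → ℕ → [0,∞]
  partialSum u zero    = [ 0₊ ]
  partialSum u (suc n) = partialSum u n +⁺ u n

  ∑∞ : (ℕ → [0,∞]) → [0,∞]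
  ∑∞ u = ⨆ λ t → ∃ λ n → t ≡ partialSum u n

  infix 4 _⟶0
  _⟶0 : (ℕ → [0,∞]) → Set
  u ⟶0 = ∀ ε (0<ε : 0# < ε) → ∃ λ N → ∀ n → N ℕ.≤ n → u n <⁺ [ ε , proj₁ 0<ε ]

  -- By excluded middle, small predicates represent all subsets of X, whatever
  -- the level of X.  `μ` takes a proof of measurability; `μ-cong` says that it
  -- depends neither on that proof nor on the predicate representing the subset.
  record MeasureSpace a m : Set (lsuc (a ⊔ˡ m)) where
    field
      X            : Set a
      Measurable   : Pred (Pred X 0ℓ) m
      measurable-≐ : ∀ {A B} → A ≐ B → Measurable A → Measurable B
      measurable-U : Measurable U
      measurable-∁ : ∀ {A} → Measurable A → Measurable (∁ A)
      measurable-⋃ : ∀ {A : ℕ → Pred X 0ℓ} → (∀ n → Measurable (A n)) →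
                     Measurable (⋃ ℕ A)
      μ            : ∀ {A} → Measurable A → [0,∞]
      μ-cong       : ∀ {A B} (𝑎 : Measurable A) (𝑏 : Measurable B) →
                     A ≐ B → μ 𝑎 ≈⁺ μ 𝑏
      μ-∅          : (𝑒 : Measurable ∅) → μ 𝑒 ≈⁺ [ 0₊ ]
      μ-⋃          : ∀ {A : ℕ → Pred X 0ℓ} (𝑎 : ∀ n → Measurable (A n)) →
                     (∀ i j → i ≢ j → A i ⊥ A j) →
                     μ (measurable-⋃ 𝑎) ≈⁺ ∑∞ (μ ∘ 𝑎)

  module _ (M : MeasureSpace a m) where
    open MeasureSpace M

    -- The range of `fun` is finite: `values` lists each of its elements exactly
    -- once, and nothing else.  Hence a sum over all v ∈ ℝ of terms that vanish
    -- unless `fun` takes the value v is the sum over `values`.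
    record SimpleFunction : Set (a ⊔ˡ m) where
      field
        fun        : X → ℝ
        values     : List ℝ
        unique     : UniqueSetoid.Unique setoid values
        covered    : ∀ x → Any (fun x ≈_) values
        attained   : All (λ v → ∃ λ x → fun x ≈ v) values
        measurable : ∀ v → Measurable (λ x → fun x ≈ v)

    open SimpleFunction

    NonNegative : (X → ℝ) → Set a
    NonNegative h = ∀ x → 0# ≤ h x

    values₊ : (ψ : SimpleFunction) → NonNegative (fun ψ) → List ℝ≥0
    values₊ ψ ψ≥0 =
      All.toList (All.map (λ (x , ψx≈v) → ≤-respʳ-≈ ψx≈v (ψ≥0 x)) (attained ψ))

    integralSF₊ : (ψ : SimpleFunction) → NonNegative (fun ψ) → [0,∞]
    integralSF₊ ψ ψ≥0 =
      foldr _+⁺_ [ 0₊ ]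
        (map (λ v → v ·⁺ μ (measurable ψ (proj₁ v))) (values₊ ψ ψ≥0))

    -- The Lebesgue integral; only meaningful for nonnegative measurable h.
    lebesgueIntegral : (X → ℝ) → [0,∞]
    lebesgueIntegral h =
      ⨆ λ t → Σ SimpleFunction λ ψ → Σ (NonNegative (fun ψ)) λ ψ≥0 →
        (∀ x → fun ψ x ≤ h x) × t ≡ integralSF₊ ψ ψ≥0

    Integrable : SimpleFunction → Set
    Integrable s = ∀ v → v ≉ 0# → μ (measurable s v) <⁺ ∞

    -- For an integrable simple function the second clause is met only at v ≈ 0,
    -- where it is the convention ∞ · 0 = 0.
    scale : [0,∞] → ℝ → ℝ
    scale [ r , _ ] v = r * v
    scale ∞         v = 0#

    integralSF : SimpleFunction → ℝ
    integralSF s =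
      foldr _+_ 0# (map (λ v → scale (μ (measurable s v)) v) (values s))

    record Approximates (s : ℕ → SimpleFunction) (f : X → ℝ) : Set (a ⊔ˡ m) where
      field
        integrable : ∀ n → Integrable (s n)
        pointwise  : ∀ x → (λ n → fun (s n) x) ⟶ f x
        inMean     : (λ n → lebesgueIntegral (λ x → ∣ f x - fun (s n) x ∣)) ⟶0

    BochnerIntegrable : (X → ℝ) → Set (a ⊔ˡ m)
    BochnerIntegrable f = ∃ λ s → Approximates s f

    -- I is the limit of the integrals of s n, for every choice of (s n).
    IsBochnerIntegral : (X → ℝ) → ℝ → Set (a ⊔ˡ m)
    IsBochnerIntegral f I =
      BochnerIntegrable f × (∀ s → Approximates s f → (integralSF ∘ s) ⟶ I)

{-# OPTIONS --safe #-}
module Submission where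

-- Sums of indicators are compared by refining X along their finitely many
-- events until each sum is constant, so simple functions have a monotone and
-- additive integral.  Let s be integrable simple with ∫|f - s| ≤ δ.
-- If ψ ≤ f is simple then ψ + s⁻ ≤ s⁺ + (ψ - s)⁺ and (ψ - s)⁺ ≤ |f - s|, whence
-- ∫f ≤ ∫s + δ.  Conversely let ψ round min(f , s⁺) down to a multiple of η; it is
-- simple because f, a limit of simple functions, is measurable.  Then
-- s⁺ ≤ ψ + (s - ψ - η)⁺ + η·[s > 0] and (s - ψ - η)⁺ ≤ |f - s|, whence
-- ∫s ≤ ∫f + δ + η·μ[s > 0], where μ[s > 0] is finite and η arbitrary.

open import Defs
open import Level using (Level; 0ℓ) renaming (suc to lsuc; _⊔_ to _⊔ˡ_)
open import Algebra.Bundles using (CommutativeMonoid)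
open import Axiom.ExcludedMiddle using (ExcludedMiddle)
open import Data.List.Base
  using (List; []; _∷_; _++_; map; foldr; filter; deduplicate; cartesianProductWith)
import Data.List.Membership.Setoid.Properties as Membership
open import Data.List.Relation.Unary.All as All using (All; []; _∷_)
open import Data.List.Relation.Unary.All.Properties using (++⁻ˡ; ++⁻ʳ; all-filter)
open import Data.List.Relation.Unary.AllPairs.Core using (_∷_)
open import Data.List.Relation.Unary.Any as Any using (Any; here; there)
import Data.List.Relation.Unary.Unique.DecSetoid.Properties as UniqueDec
import Data.List.Relation.Unary.Unique.Setoid as UniqueSetoid
import Data.List.Relation.Unary.Unique.Setoid.Properties as Unique
open import Data.Nat.Base as ℕ using (ℕ; zero; suc)
import Data.Nat.Properties as ℕ
open import Data.Product.Base using (Σ; ∃; _×_; _,_; proj₁; proj₂)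
open import Data.Sum.Base using (_⊎_; inj₁; inj₂; [_,_]′)
open import Function.Base using (_on_; _∘_)
open import Relation.Binary.Bundles using (DecSetoid; Poset; TotalOrder)
import Relation.Binary.Construct.Add.Supremum.NonStrict as AddSupNonStrict
import Relation.Binary.Construct.On as On
open import Relation.Binary.Definitions using (_Respects_)
open import Relation.Binary.PropositionalEquality.Core as ≡ using (_≡_; _≢_)
open import Relation.Nullary.Construct.Add.Supremum using ([_])
open import Relation.Nullary.Decidable.Core using (Dec; yes; no; decidable-stable)
open import Relation.Nullary.Negation.Core using (¬_; contradiction)
open import Relation.Unary using (Pred; _≐_; _⊆_; _∩_; _∪_; _⊥_; ∁; ∅; ⋃; ⋂)

-- There is no subtraction in [0,∞], so both inequalities are arranged with nonnegative terms on
-- each side; only the finite integral of s⁻ is ever cancelled, after passing to ℝ. The function |f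
-- - s| is met only through simple functions below it, so each error term has to be simple itself.
-- The second inequality is the harder one: s need not lie below f, so a simple function under f has
-- to be built. Taking the minimum with s⁺ bounds it, so that finitely many multiples of η suffice,
-- and still leaves s ≤ min(f , s⁺) + |f - s|. Charging the rounding error only where s > 0 keeps it
-- finite on a space of infinite measure. The estimates concern one s at a time, so they apply to
-- every approximating sequence and yield existence and uniqueness of the limit together.

-- Arithmetic, the Archimedean property and rounding in a complete ordered field.

module OrderedField (em : ∀ {ℓ} → ExcludedMiddle ℓ) (𝓡 : CompleteOrderedField) where

  open CompleteOrderedField 𝓡
  open import Algebra.Construct.NaturalChoice.Max totalOrder
    using (x≤x⊔y; x≤y⊔x; ⊔-lub; x≤y⇒x⊔y≈y; x≤y⇒y⊔x≈y)
  open import Algebra.Properties.AbelianGroup +-abelianGroup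
    using (⁻¹-anti-homo‿-) renaming (//-rightDividesˡ to x-y+y≈x; //-rightDividesʳ to x+y-y≈x)
  open import Algebra.Properties.Ring ring using (-‿distribˡ-*; -‿distribʳ-*; -‿involutive)
  open import Algebra.Properties.Monoid.Mult +-monoid public using () renaming (_×_ to _×ℕ_)
  open import Relation.Binary.Reasoning.PartialOrder (TotalOrder.poset totalOrder)

  +-monoʳ-≤ : ∀ {x y} z → x ≤ y → z + x ≤ z + y
  +-monoʳ-≤ {x} {y} z x≤y = begin
    z + x  ≈⟨ +-comm z x ⟩
    x + z  ≤⟨ +-monoˡ-≤ z x≤y ⟩
    y + z  ≈⟨ +-comm y z ⟩
    z + y  ∎

  +-mono-≤ : ∀ {x y u v} → x ≤ y → u ≤ v → x + u ≤ y + v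
  +-mono-≤ x≤y u≤v = ≤-trans (+-monoˡ-≤ _ x≤y) (+-monoʳ-≤ _ u≤v)

  +-cancelʳ-≤ : ∀ {x y} z → x + z ≤ y + z → x ≤ y
  +-cancelʳ-≤ {x} {y} z x+z≤y+z = begin
    x          ≈⟨ x+y-y≈x z x ⟨
    x + z - z  ≤⟨ +-monoˡ-≤ (- z) x+z≤y+z ⟩
    y + z - z  ≈⟨ x+y-y≈x z y ⟩
    y          ∎

  x-y≤z⇒x≤z+y : ∀ {x y z} → x - y ≤ z → x ≤ z + y
  x-y≤z⇒x≤z+y {x} {y} x-y≤z = ≤-respˡ-≈ (x-y+y≈x y x) (+-monoˡ-≤ y x-y≤z)

  x≤z+y⇒x-y≤z : ∀ {x y z} → x ≤ z + y → x - y ≤ z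
  x≤z+y⇒x-y≤z {x} {y} x≤z+y = +-cancelʳ-≤ y (≤-respˡ-≈ (≈-sym (x-y+y≈x y x)) x≤z+y)

  x≤z-y⇒x+y≤z : ∀ {x y z} → x ≤ z - y → x + y ≤ z
  x≤z-y⇒x+y≤z {x} {y} {z} x≤z-y = ≤-respʳ-≈ (x-y+y≈x y z) (+-monoˡ-≤ y x≤z-y)

  x+y≤z⇒x≤z-y : ∀ {x y z} → x + y ≤ z → x ≤ z - y
  x+y≤z⇒x≤z-y {x} {y} {z} x+y≤z = +-cancelʳ-≤ y (≤-respʳ-≈ (≈-sym (x-y+y≈x y z)) x+y≤z)

  x≤y+x : ∀ {x y} → 0# ≤ y → x ≤ y + x
  x≤y+x {x} 0≤y = ≤-respˡ-≈ (+-identityˡ x) (+-monoˡ-≤ x 0≤y)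

  x≤x+y : ∀ {x y} → 0# ≤ y → x ≤ x + y
  x≤x+y {x} {y} 0≤y = ≤-respʳ-≈ (+-comm y x) (x≤y+x 0≤y)

  0≤x+y : ∀ {x y} → 0# ≤ x → 0# ≤ y → 0# ≤ x + y
  0≤x+y 0≤x 0≤y = ≤-trans 0≤x (x≤x+y 0≤y)

  x≤0⇒0≤-x : ∀ {x} → x ≤ 0# → 0# ≤ - x
  x≤0⇒0≤-x {x} x≤0 = +-cancelʳ-≤ x (begin
    0# + x   ≈⟨ +-identityˡ x ⟩
    x        ≤⟨ x≤0 ⟩
    0#       ≈⟨ -‿inverseˡ x ⟨
    - x + x  ∎)

  *-monoˡ-≤ : ∀ {x y z} → 0# ≤ z → x ≤ y → z * x ≤ z * y
  *-monoˡ-≤ {x} {y} {z} 0≤z x≤y = begin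
    z * x            ≤⟨ x≤y+x (*-nonNeg 0≤z (x+y≤z⇒x≤z-y (≤-respˡ-≈ (≈-sym (+-identityˡ x)) x≤y))) ⟩
    z * (y - x) + z * x ≈⟨ distribˡ z (y - x) x ⟨
    z * (y - x + x)  ≈⟨ *-congˡ (x-y+y≈x x y) ⟩
    z * y            ∎

  *-monoʳ-≤ : ∀ {x y z} → 0# ≤ z → x ≤ y → x * z ≤ y * z
  *-monoʳ-≤ {x} {y} {z} 0≤z x≤y = begin
    x * z  ≈⟨ *-comm x z ⟩
    z * x  ≤⟨ *-monoˡ-≤ 0≤z x≤y ⟩
    z * y  ≈⟨ *-comm z y ⟩
    y * z  ∎

  ≰⇒≥ : ∀ {x y} → ¬ x ≤ y → y ≤ x
  ≰⇒≥ {x} {y} x≰y with total x y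
  ... | inj₁ x≤y = contradiction x≤y x≰y
  ... | inj₂ y≤x = y≤x

  <⇒≱ : ∀ {x y} → x < y → ¬ y ≤ x
  <⇒≱ (x≤y , x≉y) y≤x = x≉y (antisym x≤y y≤x)

  ≱⇒< : ∀ {x y} → ¬ y ≤ x → x < y
  ≱⇒< y≰x = ≰⇒≥ y≰x , λ x≈y → y≰x (≤-reflexive (≈-sym x≈y))

  ≤-<-trans : ∀ {x y z} → x ≤ y → y < z → x < z
  ≤-<-trans x≤y y<z = ≱⇒< λ z≤x → <⇒≱ y<z (≤-trans z≤x x≤y)

  0≤x*x : ∀ x → 0# ≤ x * x
  0≤x*x x with total 0# x
  ... | inj₁ 0≤x = *-nonNeg 0≤x 0≤x
  ... | inj₂ x≤0 = begin
    0#         ≤⟨ *-nonNeg (x≤0⇒0≤-x x≤0) (x≤0⇒0≤-x x≤0) ⟩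
    - x * - x  ≈⟨ -x*-y≈x*y ⟩
    x * x      ∎
    where
    -x*-y≈x*y : - x * - x ≈ x * x
    -x*-y≈x*y = ≈-trans (≈-sym (-‿distribˡ-* x (- x)))
      (≈-trans (-‿cong (≈-sym (-‿distribʳ-* x x))) (-‿involutive (x * x)))

  0≤1 : 0# ≤ 1#
  0≤1 = ≤-respʳ-≈ (*-identityˡ 1#) (0≤x*x 1#)

  0<1 : 0# < 1#
  0<1 = 0≤1 , 0≉1

  divide : ∀ {t ε} → 0# < t → 0# < ε → ∃ λ η → 0# < η × t * η ≈ ε
  divide {t} {ε} (0≤t , 0≉t) (0≤ε , 0≉ε) =
    i * ε , ( *-nonNeg 0≤i 0≤ε
            , λ 0≈iε → 0≉ε (≈-trans (≈-sym (zeroʳ t)) (≈-trans (*-congˡ 0≈iε) t*iε≈ε)) )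
          , t*iε≈ε
    where
    i = proj₁ (inverse t λ t≈0 → 0≉t (≈-sym t≈0))
    ti≈1 = proj₂ (inverse t λ t≈0 → 0≉t (≈-sym t≈0))
    t*iε≈ε : t * (i * ε) ≈ ε
    t*iε≈ε = ≈-trans (≈-sym (*-assoc t i ε)) (≈-trans (*-congʳ ti≈1) (*-identityˡ ε))
    0≤i : 0# ≤ i
    0≤i with total 0# i
    ... | inj₁ 0≤i = 0≤i
    ... | inj₂ i≤0 = contradiction (antisym 0≤1 (begin
      1#      ≈⟨ ti≈1 ⟨
      t * i   ≤⟨ *-monoˡ-≤ 0≤t i≤0 ⟩
      t * 0#  ≈⟨ zeroʳ t ⟩
      0#      ∎)) 0≉1

  -- If all multiples of η stayed below c, they would have a least upper bound s. The successor of
  -- each multiple is again at most s, so s - η would be a smaller upper bound.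
  archimedean : ∀ {η} → 0# < η → ∀ c → ∃ λ K → c ≤ K ×ℕ η
  archimedean {η} 0<η c with em {P = ∃ λ K → c ≤ K ×ℕ η}
  ... | yes p = p
  ... | no ∄K = contradiction s≤s-η λ s≤s-η → <⇒≱ 0<η (+-cancelʳ-≤ s (begin
    η + s  ≈⟨ +-comm η s ⟩
    s + η  ≤⟨ x≤z-y⇒x+y≤z s≤s-η ⟩
    s      ≈⟨ +-identityˡ s ⟨
    0# + s ∎))
    where
    Multiple : Carrier → Set
    Multiple r = ∃ λ K → r ≈ K ×ℕ η
    bounded : IsUpperBound _≤_ Multiple c
    bounded r (K , r≈Kη) = ≤-respˡ-≈ (≈-sym r≈Kη) (≰⇒≥ λ c≤Kη → ∄K (K , c≤Kη))
    lub = complete Multiple (0# , 0 , ≈-refl) (c , bounded)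
    s = proj₁ lub
    s≤s-η : s ≤ s - η
    s≤s-η = proj₂ (proj₂ lub) (s - η) λ r (K , r≈Kη) → x+y≤z⇒x≤z-y (begin
      r + η       ≈⟨ +-congʳ r≈Kη ⟩
      K ×ℕ η + η  ≈⟨ +-comm _ η ⟩
      suc K ×ℕ η  ≤⟨ proj₁ (proj₂ lub) _ (suc K , ≈-refl) ⟩
      s           ∎)

  ×ℕ-nonNeg : ∀ {x} K → 0# ≤ x → 0# ≤ K ×ℕ x
  ×ℕ-nonNeg zero    0≤x = ≤-refl
  ×ℕ-nonNeg (suc K) 0≤x = 0≤x+y 0≤x (×ℕ-nonNeg K 0≤x)

  ×ℕ-pos : ∀ {x} K → 0# < x → 0# < suc K ×ℕ x
  ×ℕ-pos {x} K 0<x@(0≤x , _) = ≱⇒< λ ≤0 → <⇒≱ 0<x (≤-trans (x≤x+y (×ℕ-nonNeg K 0≤x)) ≤0)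

  ×ℕ-*-1 : ∀ K x → (K ×ℕ 1#) * x ≈ K ×ℕ x
  ×ℕ-*-1 zero    x = zeroˡ x
  ×ℕ-*-1 (suc K) x = ≈-trans (distribʳ x 1# (K ×ℕ 1#)) (+-cong (*-identityˡ x) (×ℕ-*-1 K x))

  1/suc : ∀ k → ∃ λ η → 0# < η × (suc k ×ℕ 1#) * η ≈ 1#
  1/suc k = divide (×ℕ-pos k 0<1) 0<1

  -- The tolerances 1/(k + 1): a sequence of them suffices to express limits, which turns limit
  -- conditions into countable intersections.
  recip : ℕ → Carrier
  recip k = proj₁ (1/suc k)

  0<recip : ∀ k → 0# < recip k
  0<recip k = proj₁ (proj₂ (1/suc k))

  recip-small : ∀ {d} → 0# < d → ∃ λ k → recip k ≤ d
  recip-small {d} 0<d with archimedean 0<d 1#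
  ... | K , 1≤Kd = K , (begin
    e            ≈⟨ cancel e ⟨
    e * (t * e)  ≤⟨ *-monoˡ-≤ (proj₁ (0<recip K)) (begin
                      t * e       ≈⟨ te≈1 ⟩
                      1#          ≤⟨ 1≤Kd ⟩
                      K ×ℕ d      ≤⟨ x≤y+x (proj₁ 0<d) ⟩
                      suc K ×ℕ d  ≈⟨ ×ℕ-*-1 (suc K) d ⟨
                      t * d       ∎) ⟩
    e * (t * d)  ≈⟨ cancel d ⟩
    d            ∎)
    where
    e = recip K
    t = suc K ×ℕ 1#
    te≈1 = proj₂ (proj₂ (1/suc K))
    cancel : ∀ x → e * (t * x) ≈ x
    cancel x = ≈-trans (≈-sym (*-assoc e t x))
      (≈-trans (*-congʳ (≈-trans (*-comm e t) te≈1)) (*-identityˡ x))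

  third : ∀ {ε} → 0# < ε → ∃ λ η → 0# < η × η + (η + η) ≈ ε
  third {ε} 0<ε with divide (×ℕ-pos 2 0<1) 0<ε
  ... | η , 0<η , 3η≈ε = η , 0<η ,
    ≈-trans (+-congˡ (+-congˡ (≈-sym (+-identityʳ η)))) (≈-trans (≈-sym (×ℕ-*-1 3 η)) 3η≈ε)

  -- Otherwise x - y is positive, and two tolerances below a third of it cannot reach it. Two are
  -- allowed because `measurable-limit` spends one on the event and one on the convergence.
  ≤-from-ε : ∀ {x y} → (∀ k → x ≤ y + (recip k + recip k)) → x ≤ y
  ≤-from-ε {x} {y} x≤y+2/k with em {P = x ≤ y}
  ... | yes x≤y = x≤y
  ... | no  x≰y with third (≱⇒< {0#} {x - y} λ x-y≤0 →
                        x≰y (≤-respʳ-≈ (+-identityˡ y) (x-y≤z⇒x≤z+y x-y≤0)))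
  ... | η , 0<η , 3η≈x-y with recip-small 0<η
  ... | k , 1/k≤η = contradiction (+-cancelʳ-≤ (η + η) (begin
    η + (η + η)            ≈⟨ 3η≈x-y ⟩
    x - y                  ≤⟨ x≤z+y⇒x-y≤z (≤-respʳ-≈ (+-comm y _) (x≤y+2/k k)) ⟩
    recip k + recip k      ≤⟨ +-mono-≤ 1/k≤η 1/k≤η ⟩
    η + η                  ≈⟨ +-identityˡ _ ⟨
    0# + (η + η)           ∎)) (<⇒≱ 0<η)

  _⁺ᵖ _⁻ᵖ : Carrier → Carrier
  x ⁺ᵖ = x ⊔ 0#
  x ⁻ᵖ = (- x) ⊔ 0#

  ⁺ᵖ-nonNeg : ∀ x → 0# ≤ x ⁺ᵖ
  ⁺ᵖ-nonNeg x = x≤y⊔x x 0#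

  ⁻ᵖ-nonNeg : ∀ x → 0# ≤ x ⁻ᵖ
  ⁻ᵖ-nonNeg x = x≤y⊔x (- x) 0#

  x≤x⁺ᵖ : ∀ x → x ≤ x ⁺ᵖ
  x≤x⁺ᵖ x = x≤x⊔y x 0#

  ⁺ᵖ-of-nonNeg : ∀ {x} → 0# ≤ x → x ⁺ᵖ ≈ x
  ⁺ᵖ-of-nonNeg = x≤y⇒y⊔x≈y

  x+x⁻≈x⁺ : ∀ x → x + x ⁻ᵖ ≈ x ⁺ᵖ
  x+x⁻≈x⁺ x = [ nonNeg , nonPos ]′ (total 0# x)
    where
    nonNeg : 0# ≤ x → x + x ⁻ᵖ ≈ x ⁺ᵖ
    nonNeg 0≤x = ≈-trans (+-congˡ (x≤y⇒x⊔y≈y -x≤0))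
                         (≈-trans (+-identityʳ x) (≈-sym (⁺ᵖ-of-nonNeg 0≤x)))
      where
      -x≤0 : - x ≤ 0#
      -x≤0 = +-cancelʳ-≤ x (begin
        - x + x  ≈⟨ -‿inverseˡ x ⟩
        0#       ≤⟨ 0≤x ⟩
        x        ≈⟨ +-identityˡ x ⟨
        0# + x   ∎)
    nonPos : x ≤ 0# → x + x ⁻ᵖ ≈ x ⁺ᵖ
    nonPos x≤0 = ≈-trans (+-congˡ (⁺ᵖ-of-nonNeg (x≤0⇒0≤-x x≤0)))
                           (≈-trans (-‿inverseʳ x) (≈-sym (x≤y⇒x⊔y≈y x≤0)))

  0≤∣x∣ : ∀ x → 0# ≤ ∣ x ∣
  0≤∣x∣ x with total 0# x
  ... | inj₁ 0≤x = ≤-trans 0≤x (x≤x⊔y x (- x))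
  ... | inj₂ x≤0 = ≤-trans (x≤0⇒0≤-x x≤0) (x≤y⊔x x (- x))

  ∣x-y∣-boundˡ : ∀ x y → x ≤ ∣ x - y ∣ + y
  ∣x-y∣-boundˡ x y = x-y≤z⇒x≤z+y (x≤x⊔y (x - y) (- (x - y)))

  ∣x-y∣-boundʳ : ∀ x y → y ≤ ∣ x - y ∣ + x
  ∣x-y∣-boundʳ x y = x-y≤z⇒x≤z+y (≤-respˡ-≈ (⁻¹-anti-homo‿- x y) (x≤y⊔x (x - y) (- (x - y))))

  ∣x-y∣-least : ∀ {x y e} → x ≤ e + y → y ≤ e + x → ∣ x - y ∣ ≤ e
  ∣x-y∣-least {x} {y} x≤e+y y≤e+x =
    ⊔-lub (x≤z+y⇒x-y≤z x≤e+y) (≤-respˡ-≈ (≈-sym (⁻¹-anti-homo‿- x y)) (x≤z+y⇒x-y≤z y≤e+x))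

  -- Rounds y ≥ 0 down to a multiple of η, but to at most K η.
  floor : Carrier → ℕ → Carrier → Carrier
  floor η zero    y = 0#
  floor η (suc K) y with em {P = η ≤ y}
  ... | yes _ = η + floor η K (y - η)
  ... | no  _ = 0#

  floor-nonNeg : ∀ {η} → 0# ≤ η → ∀ K y → 0# ≤ floor η K y
  floor-nonNeg 0≤η zero y = ≤-refl
  floor-nonNeg {η} 0≤η (suc K) y with em {P = η ≤ y}
  ... | yes _ = 0≤x+y 0≤η (floor-nonNeg 0≤η K (y - η))
  ... | no  _ = ≤-refl

  floor≤ : ∀ η K {y} → 0# ≤ y → floor η K y ≤ y
  floor≤ η zero 0≤y = 0≤y
  floor≤ η (suc K) {y} 0≤y with em {P = η ≤ y}
  ... | yes η≤y = begin
    η + floor η K (y - η)  ≤⟨ +-monoʳ-≤ η (floor≤ η K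
                                   (x+y≤z⇒x≤z-y (≤-respˡ-≈ (≈-sym (+-identityˡ η)) η≤y))) ⟩
    η + (y - η)            ≈⟨ +-comm η (y - η) ⟩
    y - η + η              ≈⟨ x-y+y≈x η y ⟩
    y                      ∎
  ... | no  _ = 0≤y

  -- The recursion stops either because less than η remains or because `K` is used up, and then the
  -- bound on y leaves nothing positive.
  ≤floor+η : ∀ η K {y} → 0# ≤ η → y ≤ K ×ℕ η → y ≤ floor η K y + η
  ≤floor+η η zero 0≤η y≤0 = ≤-trans y≤0 (≤-respʳ-≈ (≈-sym (+-identityˡ η)) 0≤η)
  ≤floor+η η (suc K) {y} 0≤η y≤Kη with em {P = η ≤ y}
  ... | yes η≤y = begin
    y                            ≈⟨ x-y+y≈x η y ⟨
    y - η + η                    ≤⟨ +-monoˡ-≤ η (≤floor+η η K 0≤η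
                                         (x≤z+y⇒x-y≤z (≤-respʳ-≈ (+-comm η _) y≤Kη))) ⟩
    floor η K (y - η) + η + η    ≈⟨ +-congʳ (+-comm _ η) ⟩
    η + floor η K (y - η) + η    ∎
  ... | no  η≰y = ≤-respʳ-≈ (≈-sym (+-identityˡ η)) (≰⇒≥ η≰y)

-- Order, addition and scaling in [0,∞].

module ExtendedReals (em : ∀ {ℓ} → ExcludedMiddle ℓ) (𝓡 : CompleteOrderedField) where

  open Integration em 𝓡
  open OrderedField em 𝓡

  infixl 6 _+₊_
  _+₊_ : ℝ≥0 → ℝ≥0 → ℝ≥0
  (u , 0≤u) +₊ (v , 0≤v) = u + v , 0≤x+y 0≤u 0≤v

  ≤⁺-poset : Poset 0ℓ 0ℓ 0ℓ
  ≤⁺-poset = record { isPartialOrder =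
    AddSupNonStrict.≤⁺-isPartialOrder (_≤_ on proj₁ {B = 0# ≤_})
      (On.isPartialOrder proj₁ (TotalOrder.isPartialOrder totalOrder)) }

  open Poset ≤⁺-poset public
    using () renaming
    ( refl to ≤⁺-refl; trans to ≤⁺-trans; antisym to ≤⁺-antisym; reflexive to ≤⁺-reflexive
    ; ≤-respˡ-≈ to ≤⁺-respˡ-≈⁺; ≤-respʳ-≈ to ≤⁺-respʳ-≈⁺)
  open Poset.Eq ≤⁺-poset public
    using () renaming (refl to ≈⁺-refl; sym to ≈⁺-sym; trans to ≈⁺-trans)

  [≤]⁻¹ : ∀ {u v} → [ u ] ≤⁺ [ v ] → proj₁ u ≤ proj₁ v
  [≤]⁻¹ [ u≤v ] = u≤v

  [≈]⁻¹ : ∀ {u v} → [ u ] ≈⁺ [ v ] → proj₁ u ≈ proj₁ v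
  [≈]⁻¹ [ u≈v ] = u≈v

  ≡⇒≈⁺ : ∀ {t u} → t ≡ u → t ≈⁺ u
  ≡⇒≈⁺ ≡.refl = ≈⁺-refl

  0≤⁺ : ∀ t → [ 0₊ ] ≤⁺ t
  0≤⁺ [ _ , 0≤r ] = [ 0≤r ]
  0≤⁺ ∞           = _ ≤⊤⁺

  +⁺-∞ : ∀ t → t +⁺ ∞ ≡ ∞
  +⁺-∞ [ _ ] = ≡.refl
  +⁺-∞ ∞     = ≡.refl

  +⁺-cong : ∀ {t t′ u u′} → t ≈⁺ t′ → u ≈⁺ u′ → t +⁺ u ≈⁺ t′ +⁺ u′
  +⁺-cong [ p ]  [ q ]  = [ +-cong p q ]
  +⁺-cong [ _ ]  ⊤⁺≈⊤⁺ = ⊤⁺≈⊤⁺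
  +⁺-cong ⊤⁺≈⊤⁺ _      = ⊤⁺≈⊤⁺

  +⁺-assoc : ∀ t u v → (t +⁺ u) +⁺ v ≈⁺ t +⁺ (u +⁺ v)
  +⁺-assoc [ t ] [ u ] [ v ] = [ +-assoc _ _ _ ]
  +⁺-assoc [ t ] [ u ] ∞     = ⊤⁺≈⊤⁺
  +⁺-assoc [ t ] ∞     v     = ⊤⁺≈⊤⁺
  +⁺-assoc ∞     u     v     = ⊤⁺≈⊤⁺

  +⁺-comm : ∀ t u → t +⁺ u ≈⁺ u +⁺ t
  +⁺-comm [ t ] [ u ] = [ +-comm _ _ ]
  +⁺-comm [ t ] ∞     = ⊤⁺≈⊤⁺
  +⁺-comm ∞     [ u ] = ⊤⁺≈⊤⁺
  +⁺-comm ∞     ∞     = ⊤⁺≈⊤⁺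

  +⁺-identityˡ : ∀ t → [ 0₊ ] +⁺ t ≈⁺ t
  +⁺-identityˡ [ t ] = [ +-identityˡ _ ]
  +⁺-identityˡ ∞     = ⊤⁺≈⊤⁺

  +⁺-identityʳ : ∀ t → t +⁺ [ 0₊ ] ≈⁺ t
  +⁺-identityʳ t = ≈⁺-trans (+⁺-comm t [ 0₊ ]) (+⁺-identityˡ t)

  +⁺-commutativeMonoid : CommutativeMonoid 0ℓ 0ℓ
  +⁺-commutativeMonoid = record
    { Carrier = [0,∞] ; _≈_ = _≈⁺_ ; _∙_ = _+⁺_ ; ε = [ 0₊ ]
    ; isCommutativeMonoid = record
      { isMonoid = record
        { isSemigroup = record
          { isMagma = record
            { isEquivalence = Poset.isEquivalence ≤⁺-poset
            ; ∙-cong = +⁺-cong }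
          ; assoc = +⁺-assoc }
        ; identity = +⁺-identityˡ , +⁺-identityʳ }
      ; comm = +⁺-comm }
    }

  open import Algebra.Properties.CommutativeSemigroup
    (CommutativeMonoid.commutativeSemigroup +⁺-commutativeMonoid) public
    using () renaming (interchange to +⁺-interchange)

  +⁺-mono-≤⁺ : ∀ {t t′ u u′} → t ≤⁺ t′ → u ≤⁺ u′ → t +⁺ u ≤⁺ t′ +⁺ u′
  +⁺-mono-≤⁺ [ p ] [ q ]            = [ +-mono-≤ p q ]
  +⁺-mono-≤⁺ {t′ = t′} _ (_ ≤⊤⁺) rewrite +⁺-∞ t′ = _ ≤⊤⁺
  +⁺-mono-≤⁺ (_ ≤⊤⁺) [ _ ]          = _ ≤⊤⁺

  zero-·⁺ : ∀ {v} t → proj₁ v ≈ 0# → v ·⁺ t ≈⁺ [ 0₊ ]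
  zero-·⁺ [ r ] v≈0 = [ ≈-trans (*-congʳ v≈0) (zeroˡ _) ]
  zero-·⁺ {v} ∞ v≈0 with em {P = proj₁ v ≈ 0#}
  ... | yes _   = ≈⁺-refl
  ... | no  v≉0 = contradiction v≈0 v≉0

  pos-·⁺-∞ : ∀ {v} → proj₁ v ≉ 0# → v ·⁺ ∞ ≡ ∞
  pos-·⁺-∞ {v} v≉0 with em {P = proj₁ v ≈ 0#}
  ... | yes v≈0 = contradiction v≈0 v≉0
  ... | no  _   = ≡.refl

  ·⁺-zero : ∀ v → v ·⁺ [ 0₊ ] ≈⁺ [ 0₊ ]
  ·⁺-zero v = [ zeroʳ _ ]

  ·⁺-cong : ∀ {u v t t′} → proj₁ u ≈ proj₁ v → t ≈⁺ t′ → u ·⁺ t ≈⁺ v ·⁺ t′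
  ·⁺-cong u≈v [ r≈r′ ] = [ *-cong u≈v r≈r′ ]
  ·⁺-cong {u} {v} u≈v ⊤⁺≈⊤⁺ with em {P = proj₁ v ≈ 0#}
  ... | yes v≈0 = zero-·⁺ {u} ∞ (≈-trans u≈v v≈0)
  ... | no  v≉0 = ≡⇒≈⁺ (pos-·⁺-∞ {u} (v≉0 ∘ ≈-trans (≈-sym u≈v)))

  ·⁺-distribˡ : ∀ v t u → v ·⁺ (t +⁺ u) ≈⁺ v ·⁺ t +⁺ v ·⁺ u
  ·⁺-distribˡ v t u with em {P = proj₁ v ≈ 0#}
  ... | yes v≈0 = ≈⁺-trans (zero-·⁺ {v} (t +⁺ u) v≈0) (≈⁺-sym
        (≈⁺-trans (+⁺-cong (zero-·⁺ {v} t v≈0) (zero-·⁺ {v} u v≈0)) (+⁺-identityˡ _)))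
  ·⁺-distribˡ v [ t ] [ u ] | no _ = [ distribˡ _ _ _ ]
  ·⁺-distribˡ v [ t ] ∞ | no v≉0 rewrite pos-·⁺-∞ {v} v≉0 = ⊤⁺≈⊤⁺
  ·⁺-distribˡ v ∞     u | no v≉0 rewrite pos-·⁺-∞ {v} v≉0 = ⊤⁺≈⊤⁺

  ·⁺-distribʳ : ∀ u v t → (u +₊ v) ·⁺ t ≈⁺ u ·⁺ t +⁺ v ·⁺ t
  ·⁺-distribʳ u v [ r ] = [ distribʳ _ _ _ ]
  -- Since 0 · ∞ = 0, the result depends on which coefficients vanish; a sum of nonnegative reals
  -- vanishes only if both summands do.
  ·⁺-distribʳ u v ∞ with em {P = proj₁ u ≈ 0#} | em {P = proj₁ v ≈ 0#}
  ... | yes u≈0 | yes v≈0 = ≈⁺-trans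
        (zero-·⁺ {u +₊ v} ∞ (≈-trans (+-cong u≈0 v≈0) (+-identityˡ 0#)))
        (≈⁺-sym (+⁺-identityˡ _))
  ... | no u≉0 | _ = ≡⇒≈⁺ (pos-·⁺-∞ {u +₊ v} λ u+v≈0 →
        u≉0 (antisym (≤-respʳ-≈ u+v≈0 (x≤x+y (proj₂ v))) (proj₂ u)))
  ... | yes _ | no v≉0 = ≡⇒≈⁺ (pos-·⁺-∞ {u +₊ v} λ u+v≈0 →
        v≉0 (antisym (≤-respʳ-≈ u+v≈0 (x≤y+x (proj₂ u))) (proj₂ v)))

  ·⁺-monoˡ-≤⁺ : ∀ {u v} t → proj₁ u ≤ proj₁ v → u ·⁺ t ≤⁺ v ·⁺ t
  ·⁺-monoˡ-≤⁺ [ _ , 0≤r ] u≤v = [ *-monoʳ-≤ 0≤r u≤v ]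
  ·⁺-monoˡ-≤⁺ {u} {v} ∞ u≤v with em {P = proj₁ v ≈ 0#}
  ... | yes v≈0 = ≤⁺-reflexive (zero-·⁺ {u} ∞ (antisym (≤-respʳ-≈ v≈0 u≤v) (proj₂ u)))
  ... | no  _   = _ ≤⊤⁺

  -- The partial sums are stationary from index 2 on, so the supremum is reached there. This
  -- extracts finite additivity from `μ-⋃`.
  ∑∞-two : ∀ u → (∀ n → u (suc (suc n)) ≈⁺ [ 0₊ ]) → ∑∞ u ≈⁺ u 0 +⁺ u 1
  ∑∞-two u tail≈0 = ≤⁺-antisym
    (proj₂ (proj₂ sup) _ λ t (n , t≡) → ≤⁺-respˡ-≈⁺ (≡⇒≈⁺ (≡.sym t≡)) (bound n))
    (≤⁺-respˡ-≈⁺ (two 0) (proj₁ (proj₂ sup) _ (2 , ≡.refl)))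
    where
    sup = supremum λ t → ∃ λ n → t ≡ partialSum u n
    two : ∀ n → partialSum u (2 ℕ.+ n) ≈⁺ u 0 +⁺ u 1
    two zero    = +⁺-cong (+⁺-identityˡ (u 0)) ≈⁺-refl
    two (suc n) = ≈⁺-trans (+⁺-cong (two n) (tail≈0 n)) (+⁺-identityʳ _)
    bound : ∀ n → partialSum u n ≤⁺ u 0 +⁺ u 1
    bound 0             = 0≤⁺ _
    bound 1             = ≤⁺-respˡ-≈⁺ (+⁺-comm (u 0) [ 0₊ ]) (+⁺-mono-≤⁺ ≤⁺-refl (0≤⁺ (u 1)))
    bound (suc (suc n)) = ≤⁺-reflexive (two n)

-- Nonnegative combinations of indicators and the monotonicity of their integral.

module Steps (em : ∀ {ℓ} → ExcludedMiddle ℓ) (𝓡 : CompleteOrderedField)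
  {a m : Level} (M : Integration.MeasureSpace em 𝓡 a m) where

  open Integration em 𝓡
  open OrderedField em 𝓡
  open ExtendedReals em 𝓡
  open MeasureSpace M

  private variable
    A B : Pred X 0ℓ

  -- By excluded middle the event is the whole space or empty. It allows a condition on a value to
  -- be intersected with a level set.
  measurable-const : (P : Set) → Measurable (λ _ → P)
  measurable-const P with em {P = P}
  ... | yes p = measurable-≐ ((λ _ → p) , _) measurable-U
  ... | no ¬p = measurable-≐ ((λ ¬⊤ → contradiction _ ¬⊤) , λ p → contradiction p ¬p)
                              (measurable-∁ measurable-U)

  measurable-∅ : Measurable ∅
  measurable-∅ = measurable-const _

  pair : Pred X 0ℓ → Pred X 0ℓ → ℕ → Pred X 0ℓ
  pair A B 0             = A
  pair A B 1             = B
  pair A B (suc (suc _)) = ∅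

  measurable-pair : Measurable A → Measurable B → ∀ n → Measurable (pair A B n)
  measurable-pair 𝑎 𝑏 0             = 𝑎
  measurable-pair 𝑎 𝑏 1             = 𝑏
  measurable-pair 𝑎 𝑏 (suc (suc _)) = measurable-∅

  ⋃-pair : ⋃ ℕ (pair A B) ≐ A ∪ B
  ⋃-pair = (λ { (0 , x∈A) → inj₁ x∈A ; (1 , x∈B) → inj₂ x∈B })
         , [ (λ x∈A → 0 , x∈A) , (λ x∈B → 1 , x∈B) ]′

  measurable-∪ : Measurable A → Measurable B → Measurable (A ∪ B)
  measurable-∪ 𝑎 𝑏 = measurable-≐ ⋃-pair (measurable-⋃ (measurable-pair 𝑎 𝑏))

  measurable-∩ : Measurable A → Measurable B → Measurable (A ∩ B)
  measurable-∩ 𝑎 𝑏 = measurable-≐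
    ( (λ ¬∪ → decidable-stable em (¬∪ ∘ inj₁) , decidable-stable em (¬∪ ∘ inj₂))
    , λ (x∈A , x∈B) → [ contradiction x∈A , contradiction x∈B ]′ )
    (measurable-∁ (measurable-∪ (measurable-∁ 𝑎) (measurable-∁ 𝑏)))

  measurable-⋂ : {A : ℕ → Pred X 0ℓ} → (∀ n → Measurable (A n)) → Measurable (⋂ ℕ A)
  measurable-⋂ 𝑎 = measurable-≐
    ((λ ¬⋃ n → decidable-stable em λ x∉A → ¬⋃ (n , x∉A)) , λ x∈⋂ (n , x∉A) → x∉A (x∈⋂ n))
    (measurable-∁ (measurable-⋃ (measurable-∁ ∘ 𝑎)))

  μ-empty : (𝑎 : Measurable A) → ¬ ∃ A → μ 𝑎 ≈⁺ [ 0₊ ]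
  μ-empty 𝑎 ∄A = ≈⁺-trans (μ-cong 𝑎 measurable-∅ ((λ x∈A → ∄A (_ , x∈A)) , λ ())) (μ-∅ measurable-∅)

  μ-∪ : (𝑎 : Measurable A) (𝑏 : Measurable B) → A ⊥ B →
        μ (measurable-∪ 𝑎 𝑏) ≈⁺ μ 𝑎 +⁺ μ 𝑏
  μ-∪ {A} {B} 𝑎 𝑏 A⊥B = ≈⁺-trans (μ-cong _ _ (proj₂ ⋃-pair , proj₁ ⋃-pair))
    (≈⁺-trans (μ-⋃ (measurable-pair 𝑎 𝑏) disjoint)
              (∑∞-two (μ ∘ measurable-pair 𝑎 𝑏) λ _ → μ-∅ _))
    where
    disjoint : ∀ i j → i ≢ j → pair A B i ⊥ pair A B j
    disjoint 0 0 0≢0 = contradiction ≡.refl 0≢0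
    disjoint 0 1 _   = A⊥B
    disjoint 1 0 _ (x∈B , x∈A) = A⊥B (x∈A , x∈B)
    disjoint 1 1 1≢1 = contradiction ≡.refl 1≢1
    disjoint (suc (suc _)) _ _ ()
    disjoint 0 (suc (suc _)) _ ()
    disjoint 1 (suc (suc _)) _ ()

  -- A list of steps stands for the sum of the functions coef · 1_set.
  record Step : Set (lsuc 0ℓ ⊔ˡ a ⊔ˡ m) where
    constructor step
    field
      coef       : ℝ≥0
      {set}      : Pred X 0ℓ
      measurable : Measurable set
  open Step

  -- Taking the decision as an argument makes `value` reduce once a proof matches on `em`.
  weight : ∀ {p} {P : Set p} → Dec P → ℝ≥0 → ℝ≥0
  weight (yes _) c = c
  weight (no  _) c = 0₊

  value : List Step → X → ℝ≥0
  value []       x = 0₊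
  value (s ∷ ss) x = weight (em {P = set s x}) (coef s) +₊ value ss x

  -- The domain is a parameter so that two sums can be compared cell by cell once the space is cut
  -- up.
  integralOn : Measurable B → List Step → [0,∞]
  integralOn 𝑏 []       = [ 0₊ ]
  integralOn 𝑏 (s ∷ ss) = coef s ·⁺ μ (measurable-∩ (measurable s) 𝑏) +⁺ integralOn 𝑏 ss

  integral : List Step → [0,∞]
  integral = integralOn measurable-U

  value-++ : ∀ ss ts x → proj₁ (value (ss ++ ts) x) ≈ proj₁ (value ss x) + proj₁ (value ts x)
  value-++ []       ts x = ≈-sym (+-identityˡ _)
  value-++ (s ∷ ss) ts x = ≈-trans (+-congˡ (value-++ ss ts x)) (≈-sym (+-assoc _ _ _))

  integral-++ : ∀ ss ts → integral (ss ++ ts) ≈⁺ integral ss +⁺ integral ts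
  integral-++ []       ts = ≈⁺-sym (+⁺-identityˡ _)
  integral-++ (s ∷ ss) ts = ≈⁺-trans (+⁺-cong (≈⁺-refl {s₁}) (integral-++ ss ts))
                                     (≈⁺-sym (+⁺-assoc s₁ _ _))
    where s₁ = coef s ·⁺ μ (measurable-∩ (measurable s) measurable-U)

  integralOn-split : (𝑏 : Measurable B) (𝑎 : Measurable A) → ∀ ss → integralOn 𝑏 ss ≈⁺
    integralOn (measurable-∩ 𝑏 𝑎) ss +⁺ integralOn (measurable-∩ 𝑏 (measurable-∁ 𝑎)) ss
  integralOn-split 𝑏 𝑎 [] = ≈⁺-sym (+⁺-identityˡ _)
  integralOn-split {B} {A} 𝑏 𝑎 (step c {S} 𝑠 ∷ ss) = ≈⁺-trans
    (+⁺-cong (≈⁺-trans (·⁺-cong {c} {c} ≈-refl split) (·⁺-distribˡ c (μ 𝑠₁) (μ 𝑠₂)))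
            (integralOn-split 𝑏 𝑎 ss))
    (+⁺-interchange (c ·⁺ μ 𝑠₁) (c ·⁺ μ 𝑠₂) _ _)
    where
    𝑠₁ = measurable-∩ 𝑠 (measurable-∩ 𝑏 𝑎)
    𝑠₂ = measurable-∩ 𝑠 (measurable-∩ 𝑏 (measurable-∁ 𝑎))
    cases : S ∩ B ⊆ (S ∩ (B ∩ A)) ∪ (S ∩ (B ∩ ∁ A))
    cases {x} (x∈S , x∈B) with em {P = A x}
    ... | yes x∈A = inj₁ (x∈S , x∈B , x∈A)
    ... | no  x∉A = inj₂ (x∈S , x∈B , x∉A)
    split : μ (measurable-∩ 𝑠 𝑏) ≈⁺ μ 𝑠₁ +⁺ μ 𝑠₂
    split = ≈⁺-trans
      (μ-cong _ (measurable-∪ 𝑠₁ 𝑠₂)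
        (cases , [ (λ (x∈S , x∈B , _) → x∈S , x∈B) , (λ (x∈S , x∈B , _) → x∈S , x∈B) ]′))
      (μ-∪ 𝑠₁ 𝑠₂ λ ((_ , _ , x∈A) , (_ , _ , x∉A)) → x∉A x∈A)

  -- Equivalently, the indicator of the step is constant on `B`.
  Decides : Pred X 0ℓ → Step → Set a
  Decides B s = (B ⊆ set s) ⊎ (B ⊆ ∁ (set s))

  -- Every step set meets `B` in `B` itself or in nothing, so the coefficients of the steps
  -- containing x collect into one factor of `μ 𝑏`. The point x serves to read off the constant
  -- value.
  integralOn-decided : (𝑏 : Measurable B) → ∀ {x} → B x → ∀ {ss} → All (Decides B) ss →
    integralOn 𝑏 ss ≈⁺ value ss x ·⁺ μ 𝑏
  integralOn-decided 𝑏 x∈B [] = ≈⁺-sym (zero-·⁺ {0₊} (μ 𝑏) ≈-refl)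
  integralOn-decided {B} 𝑏 {x} x∈B {step c {S} 𝑠 ∷ ss} (d ∷ ds) with em {P = S x} | d
  ... | yes x∈S | inj₂ B⊥S = contradiction x∈S (B⊥S x∈B)
  ... | no  x∉S | inj₁ B⊆S = contradiction (B⊆S x∈B) x∉S
  ... | yes _ | inj₁ B⊆S = ≈⁺-trans
    (+⁺-cong (·⁺-cong {c} {c} ≈-refl (μ-cong (measurable-∩ 𝑠 𝑏) 𝑏 (proj₂ , λ x∈B → B⊆S x∈B , x∈B)))
             (integralOn-decided 𝑏 x∈B ds))
    (≈⁺-sym (·⁺-distribʳ c (value ss x) (μ 𝑏)))
  ... | no  _ | inj₂ B⊥S = ≈⁺-trans
    (+⁺-cong (≈⁺-trans (·⁺-cong {c} {c} ≈-refl
                          (μ-empty (measurable-∩ 𝑠 𝑏) λ (_ , x∈S , x∈B) → B⊥S x∈B x∈S))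
                        (·⁺-zero c))
             (integralOn-decided 𝑏 x∈B ds))
    (≈⁺-trans (+⁺-identityˡ _)
      (·⁺-cong {value ss x} {0₊ +₊ value ss x} (≈-sym (+-identityˡ _)) (≈⁺-refl {μ 𝑏})))

  integralOn-empty : (𝑏 : Measurable B) → ¬ ∃ B → ∀ ss → integralOn 𝑏 ss ≈⁺ [ 0₊ ]
  integralOn-empty 𝑏 ∄B [] = ≈⁺-refl
  integralOn-empty 𝑏 ∄B (step c 𝑠 ∷ ss) = ≈⁺-trans
    (+⁺-cong (≈⁺-trans (·⁺-cong {c} {c} ≈-refl
                          (μ-empty (measurable-∩ 𝑠 𝑏) λ (x , _ , x∈B) → ∄B (x , x∈B)))
                        (·⁺-zero c))
             (integralOn-empty 𝑏 ∄B ss))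
    (+⁺-identityˡ _)

  -- An induction principle in place of an explicit partition into atoms. A cell that decides `ss`
  -- is cut along the set of `s`; both halves decide `s` by construction and, being smaller, still
  -- decide `ss`, so `glue` recovers the cell.
  refinement : ∀ {q} (Q : ∀ {B} → Measurable B → Set q) →
    (∀ {B A} (𝑏 : Measurable B) (𝑎 : Measurable A) →
      Q (measurable-∩ 𝑏 𝑎) → Q (measurable-∩ 𝑏 (measurable-∁ 𝑎)) → Q 𝑏) →
    ∀ ss {B} (𝑏 : Measurable B) →
    (∀ {C} (𝑐 : Measurable C) → All (Decides C) ss → Q 𝑐) → Q 𝑏
  refinement Q glue []       𝑏 Q-decided = Q-decided 𝑏 []
  refinement Q glue (s ∷ ss) 𝑏 Q-decided = refinement Q glue ss 𝑏 λ 𝑐 ds →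
    glue 𝑐 (measurable s)
      (Q-decided _ (inj₁ proj₂ ∷ All.map (λ {t} → restrict {s = t} proj₁) ds))
      (Q-decided _ (inj₂ proj₂ ∷ All.map (λ {t} → restrict {s = t} proj₁) ds))
    where
    restrict : ∀ {C D s} → D ⊆ C → Decides C s → Decides D s
    restrict D⊆C (inj₁ C⊆S) = inj₁ (λ x∈D → C⊆S (D⊆C x∈D))
    restrict D⊆C (inj₂ C⊥S) = inj₂ (λ x∈D → C⊥S (D⊆C x∈D))

  -- After refining along both lists at once, each side is a constant times the measure of the cell,
  -- and the constants are compared at any point of it.
  integral-mono : ∀ ss ts → (∀ x → proj₁ (value ss x) ≤ proj₁ (value ts x)) →
    integral ss ≤⁺ integral ts
  integral-mono ss ts ss≤ts = refinement (λ 𝑏 → integralOn 𝑏 ss ≤⁺ integralOn 𝑏 ts)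
    (λ 𝑏 𝑎 p q → ≤⁺-respʳ-≈⁺ (≈⁺-sym (integralOn-split 𝑏 𝑎 ts))
                   (≤⁺-respˡ-≈⁺ (≈⁺-sym (integralOn-split 𝑏 𝑎 ss)) (+⁺-mono-≤⁺ p q)))
    (ss ++ ts) measurable-U λ 𝑐 ds → decided 𝑐 (++⁻ˡ ss ds) (++⁻ʳ ss ds)
    where
    decided : (𝑐 : Measurable B) → All (Decides B) ss → All (Decides B) ts →
      integralOn 𝑐 ss ≤⁺ integralOn 𝑐 ts
    decided {B} 𝑐 ds es with em {P = ∃ B}
    -- An empty cell offers no point for the comparison, but both integrals over it vanish.
    ... | no  ∄B = ≤⁺-reflexive (≈⁺-trans (integralOn-empty 𝑐 ∄B ss) (≈⁺-sym (integralOn-empty 𝑐 ∄B ts)))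
    ... | yes (x , x∈B) = ≤⁺-respʳ-≈⁺ (≈⁺-sym (integralOn-decided 𝑐 x∈B es))
        (≤⁺-respˡ-≈⁺ (≈⁺-sym (integralOn-decided 𝑐 x∈B ds))
          (·⁺-monoˡ-≤⁺ {value ss x} {value ts x} (μ 𝑐) (ss≤ts x)))

-- Simple functions: their integrals, constructions and measurability.

module SimpleFunctions (em : ∀ {ℓ} → ExcludedMiddle ℓ) (𝓡 : CompleteOrderedField)
  {a m : Level} (M : Integration.MeasureSpace em 𝓡 a m) where

  open Integration em 𝓡
  open OrderedField em 𝓡
  open ExtendedReals em 𝓡
  open Steps em 𝓡 M hiding (Step)
  open MeasureSpace M
  open SimpleFunction {M = M}

  Congruent : (ℝ → ℝ≥0) → Set
  Congruent u = ∀ {v w} → v ≈ w → proj₁ (u v) ≈ proj₁ (u w)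

  -- Represents the composite of `u` with `s` over the level sets of `s`. Varying `u` gives the
  -- positive part, the negative part and the rounding error of the same `s`.
  steps : SimpleFunction M → (ℝ → ℝ≥0) → List _
  steps s u = map (λ v → step (u v) (measurable s v)) (values s)

  -- The entries are pairwise distinct and cover the range, so exactly one level set contains x and
  -- only its coefficient survives.
  value-steps : ∀ s {u} → Congruent u → ∀ x → proj₁ (value (steps s u) x) ≈ proj₁ (u (fun s x))
  value-steps s {u} u-cong x = attainedOnce (unique s) (covered s x)
    where
    valueOver : List ℝ → ℝ
    valueOver vs = proj₁ (value (map (λ v → step (u v) (measurable s v)) vs) x)
    missed : ∀ {vs} → All (fun s x ≉_) vs → valueOver vs ≈ 0#
    missed [] = ≈-refl
    missed {v ∷ vs} (sx≉v ∷ sx≉vs) with em {P = fun s x ≈ v}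
    ... | yes sx≈v = contradiction sx≈v sx≉v
    ... | no  _    = ≈-trans (+-identityˡ _) (missed sx≉vs)
    attainedOnce : ∀ {vs} → UniqueSetoid.Unique setoid vs → Any (fun s x ≈_) vs →
      valueOver vs ≈ proj₁ (u (fun s x))
    attainedOnce {v ∷ vs} (v≉vs ∷ vs-unique) sx∈v∷vs with em {P = fun s x ≈ v} | sx∈v∷vs
    ... | yes sx≈v | _          = ≈-trans
          (+-cong (u-cong (≈-sym sx≈v))
            (missed (All.map (λ v≉w sx≈w → v≉w (≈-trans (≈-sym sx≈v) sx≈w)) v≉vs)))
          (+-identityʳ _)
    ... | no  sx≉v | here sx≈v  = contradiction sx≈v sx≉v
    ... | no  _    | there sx∈vs = ≈-trans (+-identityˡ _) (attainedOnce vs-unique sx∈vs)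

  posPart negPart : ℝ → ℝ≥0
  posPart v = v ⁺ᵖ , ⁺ᵖ-nonNeg v
  negPart v = v ⁻ᵖ , ⁻ᵖ-nonNeg v

  μ-step : ∀ {A} (𝑎 : Measurable A) → μ (measurable-∩ 𝑎 measurable-U) ≈⁺ μ 𝑎
  μ-step 𝑎 = μ-cong _ _ (proj₁ , λ x∈A → x∈A , _)

  -- The listed values are attained, hence nonnegative, and `posPart` leaves them unchanged; it is
  -- there because `steps` asks for a coefficient map on all of ℝ. The induction runs over
  -- `attained ψ`, from which `values₊` is computed.
  integralSF₊≈integral : ∀ ψ ψ≥0 → integralSF₊ M ψ ψ≥0 ≈⁺ integral (steps ψ posPart)
  integralSF₊≈integral ψ ψ≥0 = go (attained ψ)
    where
    go : ∀ {vs} (vs-attained : All (λ v → ∃ λ x → fun ψ x ≈ v) vs) →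
      foldr _+⁺_ [ 0₊ ] (map (λ v → v ·⁺ μ (measurable ψ (proj₁ v)))
        (All.toList (All.map {Q = 0# ≤_} (λ (x , ψx≈v) → ≤-respʳ-≈ ψx≈v (ψ≥0 x)) vs-attained)))
      ≈⁺ integral (map (λ v → step (posPart v) (measurable ψ v)) vs)
    go [] = ≈⁺-refl
    go {v ∷ vs} ((x , ψx≈v) ∷ vs-attained) = +⁺-cong
      (·⁺-cong {_ , 0≤v} {posPart v} (≈-sym (⁺ᵖ-of-nonNeg 0≤v)) (≈⁺-sym (μ-step (measurable ψ v))))
      (go vs-attained)
      where 0≤v = ≤-respʳ-≈ ψx≈v (ψ≥0 x)

  toReal : [0,∞] → ℝ≥0
  toReal [ r ] = r
  toReal ∞     = 0₊

  infixl 7 _*₊_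
  _*₊_ : ℝ≥0 → ℝ≥0 → ℝ≥0
  (u , 0≤u) *₊ (v , 0≤v) = u * v , *-nonNeg 0≤u 0≤v

  -- The integral of u ∘ s as a real number; sets of infinite measure count as null.
  sumOver : SimpleFunction M → (ℝ → ℝ≥0) → List ℝ → ℝ≥0
  sumOver s u []       = 0₊
  sumOver s u (v ∷ vs) = u v *₊ toReal (μ (measurable s v)) +₊ sumOver s u vs

  realIntegral : SimpleFunction M → (ℝ → ℝ≥0) → ℝ≥0
  realIntegral s u = sumOver s u (values s)

  -- Only the level set at 0 can have infinite measure, and there the coefficient is 0, so replacing
  -- ∞ by 0 in `toReal` changes no term.
  integral-finite : ∀ s → Integrable M s → ∀ {u} → (∀ {v} → v ≈ 0# → proj₁ (u v) ≈ 0#) →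
    integral (steps s u) ≈⁺ [ realIntegral s u ]
  integral-finite s s-integrable {u} u0≈0 = go (values s)
    where
    term : ∀ v → u v ·⁺ μ (measurable-∩ (measurable s v) measurable-U)
                 ≈⁺ [ u v *₊ toReal (μ (measurable s v)) ]
    term v with em {P = v ≈ 0#}
    ... | yes v≈0 = ≈⁺-trans (zero-·⁺ {u v} (μ (measurable-∩ (measurable s v) measurable-U)) (u0≈0 v≈0))
        [ ≈-sym (≈-trans (*-congʳ (u0≈0 v≈0)) (zeroˡ _)) ]
    ... | no  v≉0 = ≈⁺-trans (·⁺-cong {u v} {u v} ≈-refl (μ-step (measurable s v)))
        (finite (s-integrable v v≉0))
      where
      finite : ∀ {t} → t <⁺ ∞ → u v ·⁺ t ≈⁺ [ u v *₊ toReal t ]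
      finite [ _ ]<⊤⁺ = ≈⁺-refl
    go : ∀ vs → integral (map (λ v → step (u v) (measurable s v)) vs) ≈⁺ [ sumOver s u vs ]
    go []       = ≈⁺-refl
    go (v ∷ vs) = ≈⁺-trans (+⁺-cong (term v) (go vs)) [ ≈-refl ]

  scale≈* : ∀ t v → scale M t v ≈ v * proj₁ (toReal t)
  scale≈* [ r , _ ] v = *-comm r v
  scale≈* ∞         v = ≈-sym (zeroʳ v)

  open import Algebra.Properties.CommutativeSemigroup +-commutativeSemigroup using (interchange)

  -- Termwise this is v + v⁻ = v⁺, because `scale` and `toReal` treat infinite measure alike. The
  -- additive form connects the signed integral with the [0,∞]-valued ones.
  integralSF-decomposition : ∀ s →
    integralSF M s + proj₁ (realIntegral s negPart) ≈ proj₁ (realIntegral s posPart)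
  integralSF-decomposition s = go (values s)
    where
    go : ∀ vs → foldr _+_ 0# (map (λ v → scale M (μ (measurable s v)) v) vs)
           + proj₁ (sumOver s negPart vs)
         ≈ proj₁ (sumOver s posPart vs)
    go []       = +-identityˡ 0#
    go (v ∷ vs) = ≈-trans (interchange _ _ _ _) (+-cong
      (≈-trans (+-congʳ (scale≈* (μ (measurable s v)) v))
        (≈-trans (≈-sym (distribʳ _ v (v ⁻ᵖ))) (*-congʳ (x+x⁻≈x⁺ v))))
      (go vs))

  realIntegral-scale : ∀ s η u →
    proj₁ (realIntegral s (λ v → η *₊ u v)) ≈ proj₁ η * proj₁ (realIntegral s u)
  realIntegral-scale s η u = go (values s)
    where
    go : ∀ vs → proj₁ (sumOver s (λ v → η *₊ u v) vs) ≈ proj₁ η * proj₁ (sumOver s u vs)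
    go []       = ≈-sym (zeroʳ _)
    go (v ∷ vs) = ≈-trans (+-cong (*-assoc _ _ _) (go vs)) (≈-sym (distribˡ _ _ _))

  measurable-Any : ∀ {Q : ℝ → Pred X 0ℓ} → (∀ v → Measurable (Q v)) →
    ∀ vs → Measurable (λ x → Any (λ v → Q v x) vs)
  measurable-Any 𝑞 []       = measurable-≐ ((λ ()) , λ ()) measurable-∅
  measurable-Any 𝑞 (v ∷ vs) = measurable-≐
    ([ here , there ]′ , λ { (here p) → inj₁ p ; (there p) → inj₂ p })
    (measurable-∪ (𝑞 v) (measurable-Any 𝑞 vs))

  -- The preimage is the finite union of the level sets at those listed values that satisfy `P`.
  measurable-preimage : ∀ s {P : Pred ℝ 0ℓ} → P Respects _≈_ → Measurable (P ∘ fun s)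
  measurable-preimage s {P} P-resp = measurable-≐
    ( (λ {x} any → let v , sx≈v , Pv = Any.satisfied {P = λ v → fun s x ≈ v × P v} any
                   in P-resp (≈-sym sx≈v) Pv)
    , λ {x} Psx → Any.map (λ sx≈v → sx≈v , P-resp sx≈v Psx) (covered s x) )
    (measurable-Any (λ v → measurable-∩ (measurable s v) (measurable-const (P v))) (values s))

  -- The list need only contain the range: repetitions and values not attained are removed
  -- classically. Constructions can therefore offer a crude superset of their values.
  simple : (g : X → ℝ) (vs : List ℝ) → (∀ x → Any (g x ≈_) vs) →
    (∀ v → Measurable (λ x → g x ≈ v)) → SimpleFunction M
  simple g vs g-covered g-measurable = record
    { fun        = g
    ; values     = filter attained? (deduplicate _≟_ vs)
    ; unique     = Unique.filter⁺ setoid attained? (UniqueDec.deduplicate-! ≈-decSetoid vs)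
    ; covered    = λ x → Membership.∈-filter⁺ setoid attained? (λ v≈w (y , gy≈v) → y , ≈-trans gy≈v v≈w)
        (Membership.∈-deduplicate⁺ setoid _≟_ (λ w≈v u≈v → ≈-trans u≈v (≈-sym w≈v)) (g-covered x))
        (x , ≈-refl)
    ; attained   = all-filter attained? (deduplicate _≟_ vs)
    ; measurable = g-measurable
    }
    where
    attained? : ∀ v → Dec (∃ λ x → g x ≈ v)
    attained? v = em
    _≟_ : ∀ v w → Dec (v ≈ w)
    v ≟ w = em
    ≈-decSetoid : DecSetoid 0ℓ 0ℓ
    ≈-decSetoid = record { isDecEquivalence = record { isEquivalence = isEquivalence ; _≟_ = _≟_ } }

  constant : ℝ → SimpleFunction M
  constant c = simple (λ _ → c) (c ∷ []) (λ _ → here ≈-refl) (λ v → measurable-const (c ≈ v))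

  combine : (h : ℝ → ℝ → ℝ) → (∀ {v v′ w w′} → v ≈ v′ → w ≈ w′ → h v w ≈ h v′ w′) →
    SimpleFunction M → SimpleFunction M → SimpleFunction M
  combine h h-cong s t = simple (λ x → h (fun s x) (fun t x))
    (cartesianProductWith h (values s) (values t))
    (λ x → Membership.∈-cartesianProductWith⁺ setoid setoid setoid h-cong (covered s x) (covered t x))
    -- Fixing the value w of `s` leaves a condition on `t` alone, and there are finitely many w.
    λ v → measurable-≐
      ( (λ {x} any →
          let w , sx≈w , hwtx≈v = Any.satisfied {P = λ w → fun s x ≈ w × h w (fun t x) ≈ v} any
          in ≈-trans (h-cong sx≈w ≈-refl) hwtx≈v)
      , λ {x} hsxtx≈v → Any.map (λ sx≈w → sx≈w , ≈-trans (h-cong (≈-sym sx≈w) ≈-refl) hsxtx≈v)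
                                  (covered s x) )
      (measurable-Any (λ w → measurable-∩ (measurable s w)
        (measurable-preimage t λ u≈u′ → ≈-trans (h-cong ≈-refl (≈-sym u≈u′)))) (values s))

  grid : ℝ → ℕ → List ℝ
  grid η zero    = 0# ∷ []
  grid η (suc K) = 0# ∷ map (η +_) (grid η K)

  floor∈grid : ∀ η K y → Any (floor η K y ≈_) (grid η K)
  floor∈grid η zero y = here ≈-refl
  floor∈grid η (suc K) y with em {P = η ≤ y}
  ... | yes _ = there (Membership.∈-map⁺ setoid setoid +-congˡ (floor∈grid η K (y - η)))
  ... | no  _ = here ≈-refl

  -- Quantifying over y and `P` makes the induction on `K` pass: one rounding step turns y into y -
  -- η and `P` into `P ∘ (η +_)`.
  measurable-floor : ∀ η K {y : X → ℝ} → (∀ c → Measurable (λ x → c ≤ y x)) →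
    (P : Pred ℝ 0ℓ) → Measurable (λ x → P (floor η K (y x)))
  measurable-floor η zero y-measurable P = measurable-const (P 0#)
  measurable-floor η (suc K) {y} y-measurable P = measurable-≐ (to , from)
    (measurable-∪
      (measurable-∩ (y-measurable η) (measurable-floor η K
        (λ c → measurable-≐ (x+y≤z⇒x≤z-y , x≤z-y⇒x+y≤z) (y-measurable (c + η))) (P ∘ (η +_))))
      (measurable-∩ (measurable-∁ (y-measurable η)) (measurable-const (P 0#))))
    where
    Cases : Pred X 0ℓ
    Cases x = (η ≤ y x × P (η + floor η K (y x - η))) ⊎ (¬ η ≤ y x × P 0#)
    to : ∀ {x} → Cases x → P (floor η (suc K) (y x))
    to {x} c with em {P = η ≤ y x} | c
    ... | yes _   | inj₁ (_ , p)   = p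
    ... | yes η≤y | inj₂ (η≰y , _) = contradiction η≤y η≰y
    ... | no  η≰y | inj₁ (η≤y , _) = contradiction η≤y η≰y
    ... | no  _   | inj₂ (_ , p)   = p
    from : ∀ {x} → P (floor η (suc K) (y x)) → Cases x
    from {x} p with em {P = η ≤ y x}
    ... | yes η≤y = inj₁ (η≤y , p)
    ... | no  η≰y = inj₂ (η≰y , p)

  floorSimple : ∀ η K (y : X → ℝ) → (∀ c → Measurable (λ x → c ≤ y x)) → SimpleFunction M
  floorSimple η K y y-measurable = simple (floor η K ∘ y) (grid η K)
    (floor∈grid η K ∘ y) (λ v → measurable-floor η K y-measurable (_≈ v))

  -- The bound c ≤ f x holds exactly when, for each k, eventually c ≤ s_n x + 1/(k + 1). The slack
  -- is needed because the s_n x may approach c from below. Writing late indices as `N ℕ.+ n` lets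
  -- the inner intersection range over all of ℕ.
  measurable-limit : ∀ {s : ℕ → SimpleFunction M} {f : X → ℝ} →
    (∀ x → (λ n → fun (s n) x) ⟶ f x) → ∀ c → Measurable (λ x → c ≤ f x)
  measurable-limit {s} {f} s⟶f c = measurable-≐ (to , from)
    (measurable-⋂ λ k → measurable-⋃ λ N → measurable-⋂ λ n →
      measurable-preimage (s (N ℕ.+ n)) {λ v → c ≤ v + recip k} λ v≈w → ≤-respʳ-≈ (+-congʳ v≈w))
    where
    open import Relation.Binary.Reasoning.PartialOrder (TotalOrder.poset totalOrder)
    EventuallyNear : Pred X 0ℓ
    EventuallyNear x = ∀ k → ∃ λ N → ∀ n → c ≤ fun (s (N ℕ.+ n)) x + recip k
    to : ∀ {x} → EventuallyNear x → c ≤ f x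
    to {x} near = ≤-from-ε λ k →
      let N , c≤ = near k
          N′ , close = s⟶f x (recip k) (0<recip k)
          -- This index lies past both thresholds, `N` of the event and `N′` of the convergence.
          sx = fun (s (N ℕ.+ N′)) x
      in begin
        c                                  ≤⟨ c≤ N′ ⟩
        sx + recip k                       ≤⟨ +-monoˡ-≤ _ (∣x-y∣-boundˡ sx (f x)) ⟩
        ∣ sx - f x ∣ + f x + recip k       ≤⟨ +-monoˡ-≤ _
                                                (+-monoˡ-≤ _ (proj₁ (close _ (ℕ.m≤n+m N′ N)))) ⟩
        recip k + f x + recip k            ≈⟨ +-congʳ (+-comm _ _) ⟩
        f x + recip k + recip k            ≈⟨ +-assoc _ _ _ ⟩
        f x + (recip k + recip k)          ∎
    from : ∀ {x} → c ≤ f x → EventuallyNear x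
    from {x} c≤fx k =
      let N , close = s⟶f x (recip k) (0<recip k) in N , λ n →
      let sx = fun (s (N ℕ.+ n)) x in begin
        c                    ≤⟨ c≤fx ⟩
        f x                  ≤⟨ ∣x-y∣-boundʳ sx (f x) ⟩
        ∣ sx - f x ∣ + sx    ≤⟨ +-monoˡ-≤ sx (proj₁ (close _ (ℕ.m≤m+n N n))) ⟩
        recip k + sx         ≈⟨ +-comm _ _ ⟩
        sx + recip k         ∎

  ∃-upperBound : ∀ vs → ∃ λ c → All (_≤ c) vs
  ∃-upperBound []       = 0# , []
  ∃-upperBound (v ∷ vs) with ∃-upperBound vs
  ... | c , vs≤c with total v c
  ...   | inj₁ v≤c = c , v≤c ∷ vs≤c
  ...   | inj₂ c≤v = v , ≤-refl ∷ All.map (λ w≤c → ≤-trans w≤c c≤v) vs≤c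

  bounded : ∀ s → ∃ λ c → ∀ x → fun s x ≤ c
  bounded s with ∃-upperBound (values s)
  ... | c , vs≤c = c , λ x →
    let v≤c , sx≈v = All.lookupAny vs≤c (covered s x) in ≤-respˡ-≈ (≈-sym sx≈v) v≤c

-- The two inequalities between the integrals, and the passage to the limit.

module Comparison (em : ∀ {ℓ} → ExcludedMiddle ℓ) (𝓡 : CompleteOrderedField)
  {a m : Level} (M : Integration.MeasureSpace em 𝓡 a m) where

  open Integration em 𝓡
  open OrderedField em 𝓡
  open ExtendedReals em 𝓡
  open Steps em 𝓡 M hiding (Step)
  open SimpleFunctions em 𝓡 M
  open MeasureSpace M
  open SimpleFunction {M = M}
  open import Algebra.Construct.NaturalChoice.Min totalOrder
    using (_⊓_; ⊓-glb; x⊓y≤x; x⊓y≤y; ⊓-sel)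
  open import Algebra.Construct.NaturalChoice.Max totalOrder using (⊔-congʳ; ⊔-lub; ⊔-monoˡ-≤)
  open import Relation.Binary.Reasoning.PartialOrder (TotalOrder.poset totalOrder)

  posSteps negSteps : SimpleFunction M → List _
  posSteps s = steps s posPart
  negSteps s = steps s negPart

  posPart-cong : Congruent posPart
  posPart-cong v≈w = ⊔-congʳ 0# v≈w

  negPart-cong : Congruent negPart
  negPart-cong v≈w = ⊔-congʳ 0# (-‿cong v≈w)

  posPart-zero : ∀ {v} → v ≈ 0# → proj₁ (posPart v) ≈ 0#
  posPart-zero v≈0 = ≈-trans (⁺ᵖ-of-nonNeg (≤-reflexive (≈-sym v≈0))) v≈0

  negPart-zero : ∀ {v} → v ≈ 0# → proj₁ (negPart v) ≈ 0#
  negPart-zero v≈0 = posPart-zero (≈-trans (-‿cong v≈0) -0#≈0#)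
    where open import Algebra.Properties.Ring ring using (-0#≈0#)

  value-posSteps : ∀ s x → proj₁ (value (posSteps s) x) ≈ fun s x ⁺ᵖ
  value-posSteps s = value-steps s posPart-cong

  value-negSteps : ∀ s x → proj₁ (value (negSteps s) x) ≈ fun s x ⁻ᵖ
  value-negSteps s = value-steps s negPart-cong

  -- The indicator of the positive reals: for an integrable `s`, `realIntegral s signum⁺` is the
  -- measure of the set where s > 0.
  signum⁺ : ℝ → ℝ≥0
  signum⁺ v with em {P = v ≤ 0#}
  ... | yes _ = 0₊
  ... | no  _ = 1# , 0≤1

  signum⁺-zero : ∀ {v} → v ≤ 0# → proj₁ (signum⁺ v) ≈ 0#
  signum⁺-zero {v} v≤0 with em {P = v ≤ 0#}
  ... | yes _   = ≈-refl
  ... | no  v≰0 = contradiction v≤0 v≰0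

  signum⁺-one : ∀ {v} → ¬ v ≤ 0# → proj₁ (signum⁺ v) ≈ 1#
  signum⁺-one {v} v≰0 with em {P = v ≤ 0#}
  ... | yes v≤0 = contradiction v≤0 v≰0
  ... | no  _   = ≈-refl

  signum⁺-cong : Congruent signum⁺
  signum⁺-cong {v} {w} v≈w with em {P = w ≤ 0#}
  ... | yes w≤0 = signum⁺-zero (≤-respˡ-≈ (≈-sym v≈w) w≤0)
  ... | no  w≰0 = signum⁺-one (λ v≤0 → w≰0 (≤-respˡ-≈ v≈w v≤0))

  -- The set whose supremum defines `lebesgueIntegral`, named so that the proof of its
  -- least-upper-bound property can be recovered from `supremum`.
  SimpleIntegralBelow : (X → ℝ) → Pred [0,∞] (a ⊔ˡ m)
  SimpleIntegralBelow h t = Σ (SimpleFunction M) λ ψ → Σ (NonNegative M (fun ψ)) λ ψ≥0 →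
    (∀ x → fun ψ x ≤ h x) × t ≡ integralSF₊ M ψ ψ≥0

  lebesgue-isLub : ∀ h → IsLub _≤⁺_ (SimpleIntegralBelow h) (lebesgueIntegral M h)
  lebesgue-isLub h = proj₂ (supremum (SimpleIntegralBelow h))

  simple≤lebesgue : ∀ ψ {h} → NonNegative M (fun ψ) → (∀ x → fun ψ x ≤ h x) →
    integral (posSteps ψ) ≤⁺ lebesgueIntegral M h
  simple≤lebesgue ψ {h} ψ≥0 ψ≤h = ≤⁺-respˡ-≈⁺ (integralSF₊≈integral ψ ψ≥0)
    (proj₁ (lebesgue-isLub h) _ (ψ , ψ≥0 , ψ≤h , ≡.refl))

  lebesgue-least : ∀ {h} u →
    (∀ ψ → NonNegative M (fun ψ) → (∀ x → fun ψ x ≤ h x) → integral (posSteps ψ) ≤⁺ u) →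
    lebesgueIntegral M h ≤⁺ u
  lebesgue-least {h} u ψ≤u = proj₂ (lebesgue-isLub h) u λ t (ψ , ψ≥0 , ψ≤h , t≡) →
    ≤⁺-respˡ-≈⁺ (≈⁺-trans (≈⁺-sym (integralSF₊≈integral ψ ψ≥0)) (≡⇒≈⁺ (≡.sym t≡)))
      (ψ≤u ψ ψ≥0 ψ≤h)

  module _ (f : X → ℝ) (f≥0 : NonNegative M f) (s : SimpleFunction M) (s-integrable : Integrable M s)
    {δ : ℝ≥0} (mean≤δ : lebesgueIntegral M (λ x → ∣ f x - fun s x ∣) ≤⁺ [ δ ]) where

    ∫s⁺ ∫s⁻ : ℝ≥0
    ∫s⁺ = realIntegral s posPart
    ∫s⁻ = realIntegral s negPart

    integral-s⁺ : integral (posSteps s) ≈⁺ [ ∫s⁺ ]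
    integral-s⁺ = integral-finite s s-integrable posPart-zero

    integral-s⁻ : integral (negSteps s) ≈⁺ [ ∫s⁻ ]
    integral-s⁻ = integral-finite s s-integrable negPart-zero

    excess : SimpleFunction M → SimpleFunction M
    excess ψ = combine (λ v w → (v - w) ⁺ᵖ) (λ v≈v′ w≈w′ → ⊔-congʳ 0# (+-cong v≈v′ (-‿cong w≈w′))) ψ s

    simple-bound : ∀ ψ → NonNegative M (fun ψ) → (∀ x → fun ψ x ≤ f x) →
      integral (posSteps ψ) +⁺ [ ∫s⁻ ] ≤⁺ [ ∫s⁺ ] +⁺ [ δ ]
    simple-bound ψ ψ≥0 ψ≤f = ≤⁺-respˡ-≈⁺
      (≈⁺-trans (integral-++ (posSteps ψ) (negSteps s)) (+⁺-cong ≈⁺-refl integral-s⁻))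
      (≤⁺-trans (integral-mono (posSteps ψ ++ negSteps s) (posSteps s ++ posSteps φ) pointwise)
        (≤⁺-respˡ-≈⁺ (≈⁺-sym (integral-++ (posSteps s) (posSteps φ)))
          (+⁺-mono-≤⁺ (≤⁺-reflexive integral-s⁺) (≤⁺-trans (simple≤lebesgue φ φ≥0 φ≤) mean≤δ))))
      where
      φ = excess ψ
      φ≥0 : NonNegative M (fun φ)
      φ≥0 x = ⁺ᵖ-nonNeg _
      -- This makes `φ` a competitor in the supremum that defines the mean error, so its integral is
      -- at most δ.
      φ≤ : ∀ x → fun φ x ≤ ∣ f x - fun s x ∣
      φ≤ x = ⊔-lub (x≤z+y⇒x-y≤z (≤-trans (ψ≤f x) (∣x-y∣-boundˡ (f x) (fun s x)))) (0≤∣x∣ _)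
      pointwise : ∀ x → proj₁ (value (posSteps ψ ++ negSteps s) x) ≤
        proj₁ (value (posSteps s ++ posSteps φ) x)
      pointwise x = begin
        proj₁ (value (posSteps ψ ++ negSteps s) x)  ≈⟨ value-++ (posSteps ψ) (negSteps s) x ⟩
        proj₁ (value (posSteps ψ) x) + proj₁ (value (negSteps s) x)
          ≈⟨ +-cong (≈-trans (value-posSteps ψ x) (⁺ᵖ-of-nonNeg (ψ≥0 x))) (value-negSteps s x) ⟩
        fun ψ x + sx ⁻ᵖ            ≤⟨ +-monoˡ-≤ _ (x-y≤z⇒x≤z+y (x≤x⁺ᵖ (fun ψ x - sx))) ⟩
        fun φ x + sx + sx ⁻ᵖ       ≈⟨ +-assoc _ _ _ ⟩
        fun φ x + (sx + sx ⁻ᵖ)     ≈⟨ +-congˡ (x+x⁻≈x⁺ sx) ⟩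
        fun φ x + sx ⁺ᵖ            ≈⟨ +-comm _ _ ⟩
        sx ⁺ᵖ + fun φ x
          ≈⟨ +-cong (value-posSteps s x) (≈-trans (value-posSteps φ x) (⁺ᵖ-of-nonNeg (φ≥0 x))) ⟨
        proj₁ (value (posSteps s) x) + proj₁ (value (posSteps φ) x)
          ≈⟨ value-++ (posSteps s) (posSteps φ) x ⟨
        proj₁ (value (posSteps s ++ posSteps φ) x)  ∎
        where sx = fun s x

    lebesgue≤ : ∃ λ l → lebesgueIntegral M f ≈⁺ [ l ] × proj₁ l ≤ integralSF M s + proj₁ δ
    lebesgue≤ = finite (lebesgueIntegral M f) ≈⁺-refl (lebesgue-least [ b , 0≤b ] λ ψ ψ≥0 ψ≤f →
        bound (integral (posSteps ψ)) (simple-bound ψ ψ≥0 ψ≤f))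
      where
      b = integralSF M s + proj₁ δ
      cancel : ∀ {r} → r + proj₁ ∫s⁻ ≤ proj₁ ∫s⁺ + proj₁ δ → r ≤ b
      cancel {r} r+∫s⁻≤ = +-cancelʳ-≤ (proj₁ ∫s⁻) (begin
        r + proj₁ ∫s⁻                              ≤⟨ r+∫s⁻≤ ⟩
        proj₁ ∫s⁺ + proj₁ δ                        ≈⟨ +-congʳ (integralSF-decomposition s) ⟨
        integralSF M s + proj₁ ∫s⁻ + proj₁ δ       ≈⟨ xy∙z≈xz∙y _ _ _ ⟩
        b + proj₁ ∫s⁻                              ∎)
        where open import Algebra.Properties.CommutativeSemigroup +-commutativeSemigroup using (xy∙z≈xz∙y)
      -- To serve as a bound in [0,∞], `b` must be known to be nonnegative; the zero function, which
      -- lies below f, shows this.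
      0≤b : 0# ≤ b
      0≤b = cancel ([≤]⁻¹ (≤⁺-trans
        (+⁺-mono-≤⁺ (0≤⁺ (integral (posSteps (constant 0#)))) (≤⁺-refl {[ ∫s⁻ ]}))
        (simple-bound (constant 0#) (λ _ → ≤-refl) f≥0)))
      bound : ∀ t → t +⁺ [ ∫s⁻ ] ≤⁺ [ ∫s⁺ ] +⁺ [ δ ] → t ≤⁺ [ b , 0≤b ]
      bound [ r ] [ r+∫s⁻≤ ] = [ cancel r+∫s⁻≤ ]
      -- Abstracting the integral as `t` lets a match on the bound rule out ∞ and expose the real
      -- number.
      finite : ∀ t → lebesgueIntegral M f ≈⁺ t → t ≤⁺ [ b , 0≤b ] →
        ∃ λ l → lebesgueIntegral M f ≈⁺ [ l ] × proj₁ l ≤ b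
      finite [ l ] ∫f≈l [ l≤b ] = l , ∫f≈l , l≤b

    integralSF≤ : (∀ c → Measurable (λ x → c ≤ f x)) → ∀ {l} → lebesgueIntegral M f ≤⁺ [ l ] →
      ∀ {ε} → 0# < ε → integralSF M s ≤ proj₁ l + proj₁ δ + ε
    integralSF≤ f-measurable {l} ∫f≤l {ε} 0<ε = begin
      integralSF M s                 ≤⟨ x≤x+y (proj₂ ∫s⁻) ⟩
      integralSF M s + proj₁ ∫s⁻     ≈⟨ integralSF-decomposition s ⟩
      proj₁ ∫s⁺                      ≤⟨ [≤]⁻¹ ∫s⁺≤ ⟩
      proj₁ l + (proj₁ δ + proj₁ (realIntegral s tolerance)) ≈⟨ +-assoc _ _ _ ⟨
      proj₁ l + proj₁ δ + proj₁ (realIntegral s tolerance)   ≤⟨ +-monoʳ-≤ _ small ⟩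
      proj₁ l + proj₁ δ + ε          ∎
      where
      -- The grid width will be η = ε / (T + 1), so the total rounding error η T is at most ε;
      -- adding 1 keeps the divisor positive when T is 0.
      T = realIntegral s signum⁺
      0<T+1 : 0# < proj₁ T + 1#
      0<T+1 = ≱⇒< λ T+1≤0 → <⇒≱ 0<1 (≤-trans (x≤y+x (proj₂ T)) T+1≤0)
      scaled = divide 0<T+1 0<ε
      η = proj₁ scaled
      0<η = proj₁ (proj₂ scaled)
      0≤η = proj₁ 0<η
      tolerance : ℝ → ℝ≥0
      tolerance v = (η , 0≤η) *₊ signum⁺ v
      small : proj₁ (realIntegral s tolerance) ≤ ε
      small = begin
        proj₁ (realIntegral s tolerance)  ≈⟨ realIntegral-scale s (η , 0≤η) signum⁺ ⟩
        η * proj₁ T                       ≤⟨ *-monoˡ-≤ 0≤η (x≤x+y 0≤1) ⟩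
        η * (proj₁ T + 1#)                ≈⟨ *-comm _ _ ⟩
        (proj₁ T + 1#) * η                ≈⟨ proj₂ (proj₂ scaled) ⟩
        ε                                 ∎

      c = proj₁ (bounded s)
      -- Enough grid points to pass the maximum of s⁺, so that rounding y ≤ s⁺ is never cut short by
      -- the cap.
      K = proj₁ (archimedean 0<η (c ⁺ᵖ))
      s⁺≤Kη : ∀ x → fun s x ⁺ᵖ ≤ K ×ℕ η
      s⁺≤Kη x = ≤-trans (⊔-monoˡ-≤ 0# (proj₂ (bounded s) x)) (proj₂ (archimedean 0<η (c ⁺ᵖ)))

      y : X → ℝ
      y x = f x ⊓ fun s x ⁺ᵖ
      y≥0 : ∀ x → 0# ≤ y x
      y≥0 x = ⊓-glb (f≥0 x) (⁺ᵖ-nonNeg _)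
      y-measurable : ∀ c → Measurable (λ x → c ≤ y x)
      y-measurable c = measurable-≐
        ( (λ (c≤f , c≤s⁺) → ⊓-glb c≤f c≤s⁺)
        , λ {x} c≤y → ≤-trans c≤y (x⊓y≤x (f x) (fun s x ⁺ᵖ)) , ≤-trans c≤y (x⊓y≤y (f x) (fun s x ⁺ᵖ)) )
        (measurable-∩ (f-measurable c)
          (measurable-preimage s {λ v → c ≤ v ⁺ᵖ} λ v≈w → ≤-respʳ-≈ (⊔-congʳ 0# v≈w)))

      ψ : SimpleFunction M
      ψ = floorSimple η K y y-measurable
      ψ≥0 : NonNegative M (fun ψ)
      ψ≥0 x = floor-nonNeg 0≤η K (y x)
      ψ≤f : ∀ x → fun ψ x ≤ f x
      ψ≤f x = ≤-trans (floor≤ η K (y≥0 x)) (x⊓y≤x (f x) (fun s x ⁺ᵖ))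

      φ : SimpleFunction M
      φ = combine (λ v w → (v - (w + η)) ⁺ᵖ)
        (λ v≈v′ w≈w′ → ⊔-congʳ 0# (+-cong v≈v′ (-‿cong (+-congʳ w≈w′)))) s ψ
      φ≥0 : NonNegative M (fun φ)
      φ≥0 x = ⁺ᵖ-nonNeg _

      -- Where the minimum is f, this is the triangle inequality; where it is s⁺, already s ≤ s⁺.
      s≤∣f-s∣+y : ∀ x → fun s x ≤ ∣ f x - fun s x ∣ + y x
      s≤∣f-s∣+y x with ⊓-sel (f x) (fun s x ⁺ᵖ)
      ... | inj₁ y≈f  = ≤-respʳ-≈ (+-congˡ (≈-sym y≈f)) (∣x-y∣-boundʳ (f x) (fun s x))
      ... | inj₂ y≈s⁺ = ≤-respʳ-≈ (+-congˡ (≈-sym y≈s⁺)) (≤-trans (x≤x⁺ᵖ (fun s x)) (x≤y+x (0≤∣x∣ _)))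

      φ≤ : ∀ x → fun φ x ≤ ∣ f x - fun s x ∣
      φ≤ x = ⊔-lub (x≤z+y⇒x-y≤z (≤-trans (s≤∣f-s∣+y x) (+-monoʳ-≤ _
        (≤floor+η η K 0≤η (≤-trans (x⊓y≤y (f x) (fun s x ⁺ᵖ)) (s⁺≤Kη x)))))) (0≤∣x∣ _)

      s⁺≤ψ+φ+tolerance : ∀ x → fun s x ⁺ᵖ ≤ fun ψ x + (fun φ x + proj₁ (tolerance (fun s x)))
      s⁺≤ψ+φ+tolerance x with em {P = fun s x ≤ 0#}
      -- Here the left side is 0, so no rounding error has to be charged outside the set where s >
      -- 0.
      ... | yes s≤0 = ≤-trans (⊔-lub s≤0 ≤-refl)
            (0≤x+y (ψ≥0 x) (0≤x+y (φ≥0 x) (≤-reflexive (≈-sym (zeroʳ η)))))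
      ... | no  s≰0 = begin
        sx ⁺ᵖ                        ≈⟨ ⁺ᵖ-of-nonNeg (≰⇒≥ s≰0) ⟩
        sx                           ≤⟨ x-y≤z⇒x≤z+y (x≤x⁺ᵖ (sx - (fun ψ x + η))) ⟩
        fun φ x + (fun ψ x + η)      ≈⟨ x∙yz≈y∙xz _ _ _ ⟩
        fun ψ x + (fun φ x + η)      ≈⟨ +-congˡ (+-congˡ (*-identityʳ η)) ⟨
        fun ψ x + (fun φ x + η * 1#) ∎
        where
        open import Algebra.Properties.CommutativeSemigroup +-commutativeSemigroup using (x∙yz≈y∙xz)
        sx = fun s x

      tolerance-cong : Congruent tolerance
      tolerance-cong v≈w = *-congˡ (signum⁺-cong v≈w)

      pointwise : ∀ x → proj₁ (value (posSteps s) x) ≤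
        proj₁ (value (posSteps ψ ++ posSteps φ ++ steps s tolerance) x)
      pointwise x = begin
        proj₁ (value (posSteps s) x)  ≈⟨ value-posSteps s x ⟩
        fun s x ⁺ᵖ                    ≤⟨ s⁺≤ψ+φ+tolerance x ⟩
        fun ψ x + (fun φ x + proj₁ (tolerance (fun s x)))
          ≈⟨ +-cong (≈-trans (value-posSteps ψ x) (⁺ᵖ-of-nonNeg (ψ≥0 x)))
              (+-cong (≈-trans (value-posSteps φ x) (⁺ᵖ-of-nonNeg (φ≥0 x)))
                      (value-steps s tolerance-cong x)) ⟨
        proj₁ (value (posSteps ψ) x) + (proj₁ (value (posSteps φ) x) + proj₁ (value (steps s tolerance) x))
          ≈⟨ +-congˡ (value-++ (posSteps φ) (steps s tolerance) x) ⟨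
        proj₁ (value (posSteps ψ) x) + proj₁ (value (posSteps φ ++ steps s tolerance) x)
          ≈⟨ value-++ (posSteps ψ) (posSteps φ ++ steps s tolerance) x ⟨
        proj₁ (value (posSteps ψ ++ posSteps φ ++ steps s tolerance) x) ∎

      integral-tolerance : integral (steps s tolerance) ≈⁺ [ realIntegral s tolerance ]
      integral-tolerance = integral-finite s s-integrable λ v≈0 →
        ≈-trans (*-congˡ (signum⁺-zero (≤-reflexive v≈0))) (zeroʳ η)

      ∫s⁺≤ : [ ∫s⁺ ] ≤⁺ [ l ] +⁺ ([ δ ] +⁺ [ realIntegral s tolerance ])
      ∫s⁺≤ = ≤⁺-respˡ-≈⁺ integral-s⁺
        (≤⁺-trans (integral-mono (posSteps s) (posSteps ψ ++ posSteps φ ++ steps s tolerance) pointwise)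
          (≤⁺-respˡ-≈⁺ (≈⁺-sym (≈⁺-trans (integral-++ (posSteps ψ) (posSteps φ ++ steps s tolerance))
              (+⁺-cong (≈⁺-refl {integral (posSteps ψ)}) (integral-++ (posSteps φ) (steps s tolerance)))))
            (+⁺-mono-≤⁺ (≤⁺-trans (simple≤lebesgue ψ ψ≥0 ψ≤f) ∫f≤l)
              (+⁺-mono-≤⁺ (≤⁺-trans (simple≤lebesgue φ φ≥0 φ≤) mean≤δ)
                (≤⁺-reflexive integral-tolerance)))))

  <⁺⇒≤⁺ : ∀ {t u} → t <⁺ u → t ≤⁺ u
  <⁺⇒≤⁺ [ t<u ]   = [ proj₁ t<u ]
  <⁺⇒≤⁺ [ t ]<⊤⁺ = _ ≤⊤⁺

  -- A single approximant at mean distance below 1 bounds the integral of f by a real number.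
  lebesgue-isFinite : ∀ {f} → NonNegative M f → BochnerIntegrable M f →
    ∃ λ l → lebesgueIntegral M f ≈⁺ [ l ]
  lebesgue-isFinite {f} f≥0 (s , approx) =
    let N , mean<1 = Approximates.inMean approx 1# 0<1
        l , ∫f≈l , _ = lebesgue≤ f f≥0 (s N) (Approximates.integrable approx N)
                         (<⁺⇒≤⁺ (mean<1 N ℕ.≤-refl))
    in l , ∫f≈l

  integralSF⟶lebesgue : ∀ {f} → NonNegative M f → ∀ {l} → lebesgueIntegral M f ≈⁺ [ l ] →
    ∀ s → Approximates M s f → (integralSF M ∘ s) ⟶ proj₁ l
  integralSF⟶lebesgue {f} f≥0 {l} ∫f≈l s approx ε 0<ε =
    -- One η pays for the mean error, one for the rounding error, and the third makes the final
    -- inequality strict.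
    let η , 0<η , 3η≈ε = third 0<ε
        N , mean<η = inMean η 0<η
    in N , λ n N≤n →
      let mean≤η = <⁺⇒≤⁺ (mean<η n N≤n)
          l′ , ∫f≈l′ , l′≤ = lebesgue≤ f f≥0 (s n) (integrable n) mean≤η
          l≤ : proj₁ l ≤ integralSF M (s n) + η
          l≤ = ≤-respˡ-≈ ([≈]⁻¹ (≈⁺-trans (≈⁺-sym ∫f≈l′) ∫f≈l)) l′≤
          ≤l : integralSF M (s n) ≤ proj₁ l + η + η
          ≤l = integralSF≤ f f≥0 (s n) (integrable n) mean≤η (measurable-limit {s} pointwise)
                 {l} (≤⁺-reflexive ∫f≈l) 0<η
      in ≤-<-trans
        (∣x-y∣-least
          (≤-respʳ-≈ (≈-trans (+-assoc _ _ _) (+-comm _ _)) ≤l)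
          -- This direction involves no rounding and costs a single η; it is padded to match the
          -- other.
          (≤-respʳ-≈ (+-comm _ _) (≤-trans l≤ (+-monoʳ-≤ _ (x≤x+y (proj₁ 0<η))))))
        (2η<ε 0<η 3η≈ε)
    where
    open Approximates approx
    2η<ε : ∀ {η} → 0# < η → η + (η + η) ≈ ε → η + η < ε
    2η<ε {η} 0<η 3η≈ε = ≱⇒< λ ε≤2η → <⇒≱ 0<η (+-cancelʳ-≤ (η + η)
      (≤-respʳ-≈ (≈-sym (+-identityˡ _)) (≤-respˡ-≈ (≈-sym 3η≈ε) ε≤2η)))

mainTheorem3 : (em : ∀ {ℓ} → ExcludedMiddle ℓ) (𝓡 : CompleteOrderedField) →
    let open Integration em 𝓡 in
    ∀ {a m : Level} (M : MeasureSpace a m) (f : MeasureSpace.X M → ℝ) →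
    NonNegative M f →
    BochnerIntegrable M f →
    ∃ λ (I : ℝ≥0) → IsBochnerIntegral M f (proj₁ I) × [ I ] ≈⁺ lebesgueIntegral M f
mainTheorem3 em 𝓡 M f f≥0 f-integrable =
  let open ExtendedReals em 𝓡
      open Comparison em 𝓡 M
      l , ∫f≈l = lebesgue-isFinite f≥0 f-integrable
  in l , (f-integrable , integralSF⟶lebesgue f≥0 ∫f≈l) , ≈⁺-sym ∫f≈l
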